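{- Let $d\ge 2$, $L=BW_d$, and let $f\in R_d$ be a fourvolution. The set of minimal vectors of $L[1]:=L(f-1)$ is the set of all vectors $2^{ -m}v_A\varepsilon_S$, where $m\ge 0$ is an integer, $A$ is an affine subspace of $\Omega$ of dimension $2m+1$, and $S\in RM(2,d)$.
   Context: Let $\Omega=\mathbb F_2^d$ (affine space); $RM(k,d)$ is the Reed–Muller code spanned (in the power set of $\Omega$ under symmetric difference) by affine subspaces of codimension at most $k$. $V=\mathbb R^\Omega$ has basis $v_i$ with $(v_i,v_j)=2^{\lfloor d/2\rfloor}\delta_{ij}$, $v_A=\sum_{i\in A}v_i$; $\varepsilon_S$ negates $v_i$ for $i\in S$ and fixes the others; $\tau_c:v_i\mapsto v_{i+c}$. $BW_d$ is the $\mathbb Z$-span of all $2^{ -m}v_A\varepsilon_S$, $m\ge 0$, $A$ affine of dimension $2m$, $S\in RM(2,d)$. $R_d$ is the extraspecial group of order $2^{1+2d}$ generated by the $\varepsilon_S$ ($S\in RM(1,d)$) and the $\tau_c$ ($c\in\Omega$). A fourvolution is an isometry $f$ with $f^2=-1$. The lattice $L(f-1)=\{x(f-1):x\in L\}$ does not depend on the choice of the fourvolution $f\in R_d$. -}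

module Defs where

open import Data.Bool using (Bool; true; false; if_then_else_; _xor_; _∧_)
open import Data.Nat as ℕ using (ℕ; zero; suc; _≤_; _*_)
open import Data.Nat.DivMod using (_/_)
open import Data.Integer as ℤ using (ℤ; +_)
open import Data.Rational as ℚ using (ℚ; 0ℚ; 1ℚ; ½)
open import Data.List using (List; []; _∷_; map; foldr; concatMap)
open import Data.List.Relation.Unary.All using (All)
open import Data.Vec as Vec using (Vec; []; _∷_; replicate; zipWith)
open import Data.Product using (Σ; _×_; _,_; proj₁; proj₂)
open import Relation.Binary.PropositionalEquality using (_≡_)
open import Relation.Nullary using (¬_)

Ω : ℕ → Set
Ω d = Vec Bool d

zeroΩ : ∀ {d} → Ω d
zeroΩ = replicate _ false

_⊕_ : ∀ {d} → Ω d → Ω d → Ω d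
_⊕_ = zipWith _xor_

eqΩ : ∀ {d} → Ω d → Ω d → Bool
eqΩ [] [] = true
eqΩ (true ∷ x) (true ∷ y) = eqΩ x y
eqΩ (false ∷ x) (false ∷ y) = eqΩ x y
eqΩ _ _ = false

allΩ : (n : ℕ) → List (Ω n)
allΩ zero = [] ∷ []
allΩ (suc n) = concatMap (λ x → (false ∷ x) ∷ (true ∷ x) ∷ []) (allΩ n)

comb : ∀ {d k} → Vec Bool k → Vec (Ω d) k → Ω d
comb [] [] = zeroΩ
comb (true ∷ l) (b ∷ bs) = b ⊕ comb l bs
comb (false ∷ l) (b ∷ bs) = comb l bs

record Affine (d k : ℕ) : Set where
  field
    base  : Ω d
    basis : Vec (Ω d) k
    indep : ∀ (l : Vec Bool k) → comb l basis ≡ zeroΩ → l ≡ replicate k false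

point : ∀ {d k} → Affine d k → Vec Bool k → Ω d
point A l = Affine.base A ⊕ comb l (Affine.basis A)

charA : ∀ {d k} → Affine d k → Ω d → Bool
charA {k = k} A x = foldr _xor_ false (map (λ l → eqΩ x (point A l)) (allΩ k))

Subset : ℕ → Set
Subset d = Ω d → Bool

record CodimAff (d r : ℕ) : Set where
  field
    dim    : ℕ
    aff    : Affine d dim
    codim≤ : d ≤ dim ℕ.+ r

RM : (r d : ℕ) → Subset d → Set
RM r d S = Σ (List (CodimAff d r)) λ As →
  ∀ x → S x ≡ foldr _xor_ false (map (λ B → charA (CodimAff.aff B) x) As)

-- V = ℝ^Ω (coordinates are rational; all relevant vectors have dyadic coordinates)
V : ℕ → Set
V d = Ω d → ℚ

zeroV : ∀ {d} → V d
zeroV _ = 0ℚ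

_+V_ : ∀ {d} → V d → V d → V d
(x +V y) i = x i ℚ.+ y i

scale : ∀ {d} → ℚ → V d → V d
scale q x i = q ℚ.* x i

vA : ∀ {d k} → Affine d k → V d
vA A x = if charA A x then 1ℚ else 0ℚ

ε : ∀ {d} → Subset d → V d → V d
ε S x i = if S i then ℚ.- x i else x i

τ : ∀ {d} → Ω d → V d → V d
τ c x j = x (j ⊕ c)   -- v_i ↦ v_{i+c}, so coordinate j of xτ_c is x_{j-c} = x_{j+c}

pow2inv : ℕ → ℚ
pow2inv zero = 1ℚ
pow2inv (suc m) = ½ ℚ.* pow2inv m

-- inner product (v_i,v_j) = 2^{⌊d/2⌋} δ_ij ; norm (x,x)
normV : ∀ {d} → V d → ℚ
normV {d} x = (+ (2 ℕ.^ (d / 2)) ℚ./ 1) ℚ.* foldr ℚ._+_ 0ℚ (map (λ i → x i ℚ.* x i) (allΩ d))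

IsBWGen : (d : ℕ) → V d → Set
IsBWGen d x = Σ ℕ λ m → Σ (Affine d (2 * m)) λ A → Σ (Subset d) λ S →
  RM 2 d S × (∀ i → x i ≡ scale (pow2inv m) (ε S (vA A)) i)

ZSpan : ∀ {d} → (V d → Set) → V d → Set
ZSpan {d} P x = Σ (List (ℤ × V d)) λ l → All (λ p → P (proj₂ p)) l ×
  (∀ i → x i ≡ foldr (λ p acc → scale (proj₁ p ℚ./ 1) (proj₂ p) +V acc) zeroV l i)

BW : (d : ℕ) → V d → Set
BW d = ZSpan (IsBWGen d)

-- elements of R_d: words in the generators ε_S (S ∈ RM(1,d)) and τ_c (c ∈ Ω);
-- all generators are involutions, so the generated group consists of their products.
data Word (d : ℕ) : Set where
  []    : Word d
  ε∷    : (S : Subset d) → RM 1 d S → Word d → Word d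
  τ∷    : (c : Ω d) → Word d → Word d

act : ∀ {d} → Word d → V d → V d
act [] x = x
act (ε∷ S _ w) x = act w (ε S x)
act (τ∷ c w) x = act w (τ c x)

Fourvolution : ∀ {d} → Word d → Set
Fourvolution {d} f = ∀ (x : V d) i → act f (act f x) i ≡ ℚ.- x i

Lminus : ∀ {d} → (V d → Set) → Word d → V d → Set
Lminus {d} L f y = Σ (V d) λ x → L x × (∀ i → y i ≡ act f x i ℚ.- x i)

NonZeroV : ∀ {d} → V d → Set
NonZeroV x = ¬ (∀ i → x i ≡ 0ℚ)

MinimalVector : ∀ {d} → (V d → Set) → V d → Set
MinimalVector {d} L y = L y × NonZeroV y ×
  (∀ (z : V d) → L z → NonZeroV z → normV y ℚ.≤ normV z)

{-# OPTIONS --safe #-}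
module Submission where

-- Up to scaling, BW_d and its images under f − 1 form a chain of lattices Λ k (the norms in Λ k are at
-- least 2 ^ k) on which R_d acts trivially modulo the next term, with the recursion
-- Λ k = {(a, b) : a, b ∈ Λ (k − 1), a − b ∈ Λ k} when Ω is cut into two halves. Since f² = −1, L (f − 1)
-- is exactly the term after L. The recursion gives the bound 2 ^ k by induction, with equality for
-- (a, b) only if a or b vanishes or both are minimal in Λ (k − 1) and congruent modulo Λ k. Congruent
-- minimal vectors are equal, opposite or orthogonal; as the images of a under R_d span the whole space,
-- b is ± such an image, i.e. the translate of a with its signs changed by an affine function. So (a, b)
-- is again a multiple of some v_A ε_S, with the flat A and the quadratic function S glued from the halves.

open import Defs
open import Data.Bool using (Bool; true; false; if_then_else_; _xor_; _∧_; not)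
import Data.Bool.Properties as Bool
open import Data.Bool.Solver using (module xor-∧-Solver)
open import Data.Nat as ℕ using (ℕ; zero; suc; z≤n; s≤s; _≤_; _*_; _+_; _∸_; pred; ⌈_/2⌉; ⌊_/2⌋)
import Data.Nat.Properties as ℕ
open import Data.Nat.DivMod using (_/_)
open import Data.Integer as ℤ using (ℤ; +_; 0ℤ; 1ℤ; -1ℤ)
import Data.Integer.Properties as ℤ
open import Data.Integer.Tactic.RingSolver using (solve-∀)
open import Data.Rational as ℚ using (ℚ; 0ℚ; 1ℚ; ½)
import Data.Rational.Properties as ℚ
open import Data.Rational.Solver using (module +-*-Solver)
open import Data.Rational.Unnormalised as ℚᵘ using (mkℚᵘ; *≡*; *≤*)
import Data.Rational.Unnormalised.Properties as ℚᵘ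
open import Data.List using (List; []; _∷_; map; foldr; concatMap; _++_)
open import Data.List.Relation.Unary.All using (All; []; _∷_)
import Data.List.Relation.Unary.All.Properties as All
open import Data.Vec as Vec using (Vec; []; _∷_; replicate)
import Data.Vec.Properties as Vec
open import Data.Product using (Σ; ∃; _×_; _,_; proj₁; proj₂)
open import Data.Sum using (_⊎_; inj₁; inj₂; [_,_]′)
open import Data.Empty using (⊥; ⊥-elim)
open import Algebra.Bundles using (CommutativeRing)
open import Algebra.Structures using (IsCommutativeMonoid)
open import Function using (_∘_)
open import Relation.Nullary using (contradiction; yes; no)
open import Relation.Binary.PropositionalEquality

-- A flat of dimension 2m has 2m ≤ d, so the factor 2^d clears every denominator at once: BW_d
-- becomes `Λ (2 * d)`, its image under f - 1 becomes `Λ (suc (2 * d))`, and everything before the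
-- final comparison is integer arithmetic. The obstacle is parity. The natural generators
-- 2^((k-n)/2) v_A ε_S, with n = dim A, require k - n to be even; on a single point this leaves none
-- for odd k, yet the recursion must end in some lattice there. It ends in the multiples of 2^⌈k/2⌉.
-- Rounding up preserves the inclusions and the bound 2^k, and for odd k a point then carries no
-- vector of norm 2^k, so the classification stays true. The price is that generation by flats fails
-- on a point for odd k and has to start from d = 1.

Fn : ℕ → Set
Fn d = Ω d → ℤ

private variable
  k d r : ℕ
  X Y : Fn d
  S T : Subset d

infixl 6 _⊞_ _⊟_

_⊞_ _⊟_ : ∀ {d} → Fn d → Fn d → Fn d
(X ⊞ Y) x = X x ℤ.+ Y x
(X ⊟ Y) x = X x ℤ.- Y x

lo hi : ∀ {d} {B : Set} → (Ω (suc d) → B) → Ω d → B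
lo X x = X (false ∷ x)
hi X x = X (true ∷ x)

shift : ∀ {d} {B : Set} → Ω d → (Ω d → B) → Ω d → B
shift c X x = X (x ⊕ c)

signed : Bool → ℤ → ℤ
signed s a = if s then ℤ.- a else a

twist : ∀ {d} → Subset d → Fn d → Fn d
twist S X x = signed (S x) (X x)

by-halves : ∀ {d} {B : Set} {X Y : Ω (suc d) → B} → lo X ≗ lo Y → hi X ≗ hi Y → X ≗ Y
by-halves p q (false ∷ x) = p x
by-halves p q (true ∷ x) = q x

⊕-assoc : ∀ {d} (x y z : Ω d) → (x ⊕ y) ⊕ z ≡ x ⊕ (y ⊕ z)
⊕-assoc = Vec.zipWith-assoc Bool.xor-assoc

⊕-comm : ∀ {d} (x y : Ω d) → x ⊕ y ≡ y ⊕ x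
⊕-comm = Vec.zipWith-comm Bool.xor-comm

⊕-identityʳ : ∀ {d} (x : Ω d) → x ⊕ zeroΩ ≡ x
⊕-identityʳ = Vec.zipWith-identityʳ Bool.xor-identityʳ

⊕-identityˡ : ∀ {d} (x : Ω d) → zeroΩ ⊕ x ≡ x
⊕-identityˡ = Vec.zipWith-identityˡ Bool.xor-identityˡ

⊕-self : ∀ {d} (x : Ω d) → x ⊕ x ≡ zeroΩ
⊕-self [] = refl
⊕-self (b ∷ x) = cong₂ _∷_ (Bool.xor-same b) (⊕-self x)

⊕-cancelʳ : ∀ {d} (x y : Ω d) → (x ⊕ y) ⊕ y ≡ x
⊕-cancelʳ x y = trans (⊕-assoc x y y) (trans (cong (x ⊕_) (⊕-self y)) (⊕-identityʳ x))

⊕-swapʳ : ∀ {d} (x y z : Ω d) → (x ⊕ y) ⊕ z ≡ (x ⊕ z) ⊕ y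
⊕-swapʳ x y z = trans (⊕-assoc x y z) (trans (cong (x ⊕_) (⊕-comm y z)) (sym (⊕-assoc x z y)))

-- Λ k d consists of the integral points of the lattice spanned by all 2^{(k-dim A)/2} v_A ε_S with
-- k − dim A even and S ∈ RM(2,d). The node rule is Λₖ = {(a, b) : a, b ∈ Λₖ₋₁, a − b ∈ Λₖ}.
data Λ : ℕ → (d : ℕ) → Fn d → Set where
  free : ∀ {d X} → Λ 0 d X
  leaf : ∀ {k X} c → X [] ≡ + (2 ℕ.^ ⌈ suc k /2⌉) ℤ.* c → Λ (suc k) 0 X
  node : ∀ {k d X} → Λ k d (lo X) → Λ k d (hi X) → Λ (suc k) d (lo X ⊟ hi X) → Λ (suc k) (suc d) X


-- Closure properties of the lattices and triviality of translations modulo the next one.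

Λ-ext : X ≗ Y → Λ k d X → Λ k d Y
Λ-ext e free = free
Λ-ext e (leaf c p) = leaf c (trans (sym (e [])) p)
Λ-ext e (node a b s) = node (Λ-ext (e ∘ (false ∷_)) a) (Λ-ext (e ∘ (true ∷_)) b)
  (Λ-ext (λ x → cong₂ ℤ._-_ (e (false ∷ x)) (e (true ∷ x))) s)

interchange : ∀ a b c e → (a ℤ.- b) ℤ.+ (c ℤ.- e) ≡ (a ℤ.+ c) ℤ.- (b ℤ.+ e)
interchange = solve-∀

Λ-add : Λ k d X → Λ k d Y → Λ k d (X ⊞ Y)
Λ-add free _ = free
Λ-add (leaf {k} c p) (leaf c′ p′) = leaf (c ℤ.+ c′)
  (trans (cong₂ ℤ._+_ p p′) (sym (ℤ.*-distribˡ-+ (+ (2 ℕ.^ ⌈ suc k /2⌉)) c c′)))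
Λ-add {X = X} {Y = Y} (node a b s) (node a′ b′ s′) = node (Λ-add a a′) (Λ-add b b′)
  (Λ-ext (λ x → interchange (lo X x) (hi X x) (lo Y x) (hi Y x)) (Λ-add s s′))

Λ-scale : ∀ n → Λ k d X → Λ k d (λ x → n ℤ.* X x)
Λ-scale n free = free
Λ-scale n (leaf {k} c p) = leaf (n ℤ.* c) (trans (cong (n ℤ.*_) p) (lem n (+ (2 ℕ.^ ⌈ suc k /2⌉)) c))
  where
  lem : ∀ n m c → n ℤ.* (m ℤ.* c) ≡ m ℤ.* (n ℤ.* c)
  lem = solve-∀
Λ-scale {X = X} n (node a b s) = node (Λ-scale n a) (Λ-scale n b)
  (Λ-ext (λ x → lem n (lo X x) (hi X x)) (Λ-scale n s))
  where
  lem : ∀ n a b → n ℤ.* (a ℤ.- b) ≡ n ℤ.* a ℤ.- n ℤ.* b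
  lem = solve-∀

Λ-neg : Λ k d X → Λ k d (λ x → ℤ.- X x)
Λ-neg {X = X} a = Λ-ext (λ x → ℤ.-1*i≡-i (X x)) (Λ-scale -1ℤ a)

Λ-sub : Λ k d X → Λ k d Y → Λ k d (X ⊟ Y)
Λ-sub a b = Λ-add a (Λ-neg b)

Λ-zero : Λ k d (λ _ → 0ℤ)
Λ-zero {zero} = free
Λ-zero {suc k} {zero} = leaf 0ℤ (sym (ℤ.*-zeroʳ (+ (2 ℕ.^ ⌈ suc k /2⌉))))
Λ-zero {suc k} {suc d} = node Λ-zero Λ-zero Λ-zero

Λ-signed : ∀ s → Λ k d X → Λ k d (λ x → signed s (X x))
Λ-signed false a = a
Λ-signed true a = Λ-neg a

Λ-down : Λ (suc k) d X → Λ k d X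
Λ-down {zero} _ = free
Λ-down {suc k} (leaf c p) = leaf (+ (2 ℕ.^ (n ∸ m)) ℤ.* c) (trans p (begin
    + (2 ℕ.^ n) ℤ.* c                             ≡⟨ cong (λ z → + (2 ℕ.^ z) ℤ.* c) (sym (ℕ.m+[n∸m]≡n m≤n)) ⟩
    + (2 ℕ.^ (m ℕ.+ (n ∸ m))) ℤ.* c               ≡⟨ cong (λ z → + z ℤ.* c) (ℕ.^-distribˡ-+-* 2 m (n ∸ m)) ⟩
    + (2 ℕ.^ m ℕ.* 2 ℕ.^ (n ∸ m)) ℤ.* c           ≡⟨ cong (ℤ._* c) (ℤ.pos-* (2 ℕ.^ m) _) ⟩
    + (2 ℕ.^ m) ℤ.* + (2 ℕ.^ (n ∸ m)) ℤ.* c       ≡⟨ ℤ.*-assoc (+ (2 ℕ.^ m)) _ c ⟩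
    + (2 ℕ.^ m) ℤ.* (+ (2 ℕ.^ (n ∸ m)) ℤ.* c)     ∎))
  where
  open ≡-Reasoning
  m = ⌈ suc k /2⌉
  n = ⌈ suc (suc k) /2⌉
  m≤n : m ℕ.≤ n
  m≤n = ℕ.⌈n/2⌉-mono (ℕ.n≤1+n (suc k))
Λ-down {suc k} (node a b s) = node (Λ-down a) (Λ-down b) (Λ-down s)

chain : ∀ a b c → (a ℤ.- b) ℤ.+ (b ℤ.- c) ≡ a ℤ.- c
chain = solve-∀

neg-sub : ∀ a b → ℤ.- (a ℤ.- b) ≡ b ℤ.- a
neg-sub = solve-∀

double-sub : ∀ a b → (a ℤ.- b) ℤ.+ (a ℤ.- b) ≡ (a ℤ.+ a) ℤ.- (b ℤ.+ b)
double-sub = solve-∀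

-- This mirrors (f - 1)² = -2 f: two steps of the chain amount to a factor 2. On a point it is
-- ⌈(k+2)/2⌉ = ⌈k/2⌉ + 1, and the node rule is linear. `free` carries no halves, so at index 0 the
-- induction runs over d instead of over the derivation.
Λ-double : Λ k d X → Λ (2 ℕ.+ k) d (X ⊞ X)
Λ-double {d = zero} {X} free = leaf (X []) (lem (X []))
  where
  lem : ∀ a → a ℤ.+ a ≡ + 2 ℤ.* a
  lem = solve-∀
Λ-double {d = suc d} {X} free = node
  (Λ-down (Λ-double {X = lo X} free)) (Λ-down (Λ-double {X = hi X} free))
  (Λ-ext (λ x → double-sub (lo X x) (hi X x)) (Λ-double {X = lo X ⊟ hi X} free))
Λ-double (leaf {k} c p) = leaf c (trans (cong₂ ℤ._+_ p p) (lem (+ (2 ℕ.^ ⌈ suc k /2⌉)) c))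
  where
  lem : ∀ m c → m ℤ.* c ℤ.+ m ℤ.* c ≡ (m ℤ.+ (m ℤ.+ 0ℤ)) ℤ.* c
  lem = solve-∀
Λ-double {X = X} (node a b s) = node (Λ-double a) (Λ-double b)
  (Λ-ext (λ x → double-sub (lo X x) (hi X x)) (Λ-double s))

Λ-diff : Λ k (suc d) X → Λ k d (lo X ⊟ hi X)
Λ-diff free = free
Λ-diff (node a b s) = s

-- Write w = lo X - hi X. If the first coordinate of c is `false`, all three parts of the node rule
-- are instances of the induction hypothesis. If it is `true`, the halves trade places and the half
-- difference to be placed is -(shift c w - w) - 2w, whose second term is absorbed by `Λ-double`.
Λ-shift-fix : ∀ c → Λ k d X → Λ (suc k) d (shift c X ⊟ X)
Λ-shift-fix {k} {X = X} [] a = Λ-ext (λ { [] → sym (ℤ.+-inverseʳ (X [])) }) Λ-zero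
Λ-shift-fix {k} {suc d} {X = X} (c₀ ∷ c) a = build c₀ a
  where
  w = lo X ⊟ hi X
  third : ∀ c₀ → Λ k (suc d) X →
    Λ (suc k) d (lo (shift (c₀ ∷ c) X ⊟ X) ⊟ hi (shift (c₀ ∷ c) X ⊟ X))
  third false a = Λ-ext (λ x → lem (lo X (x ⊕ c)) (hi X (x ⊕ c)) (lo X x) (hi X x))
      (Λ-shift-fix c (Λ-diff a))
    where
    lem : ∀ p q r s → (p ℤ.- q) ℤ.- (r ℤ.- s) ≡ (p ℤ.- r) ℤ.- (q ℤ.- s)
    lem = solve-∀
  third true a = Λ-ext (λ x → lem (lo X (x ⊕ c)) (hi X (x ⊕ c)) (lo X x) (hi X x))
      (Λ-neg (Λ-add (Λ-shift-fix c (Λ-diff a)) (Λ-down (Λ-double {X = w} (Λ-diff a)))))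
    where
    lem : ∀ p q r s → ℤ.- (((p ℤ.- q) ℤ.- (r ℤ.- s)) ℤ.+ ((r ℤ.- s) ℤ.+ (r ℤ.- s)))
      ≡ (q ℤ.- r) ℤ.- (p ℤ.- s)
    lem = solve-∀
  build : ∀ c₀ → Λ k (suc d) X → Λ (suc k) (suc d) (shift (c₀ ∷ c) X ⊟ X)
  build c₀ free = node free free (third c₀ free)
  build false v@(node a b s) = node (Λ-shift-fix c a) (Λ-shift-fix c b) (third false v)
  build true v@(node a b s) = node
    (Λ-ext (λ x → chain (hi X (x ⊕ c)) (hi X x) (lo X x))
      (Λ-add (Λ-shift-fix c b) (Λ-ext (λ x → neg-sub (lo X x) (hi X x)) (Λ-neg s))))
    (Λ-ext (λ x → chain (lo X (x ⊕ c)) (lo X x) (hi X x)) (Λ-add (Λ-shift-fix c a) s))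
    (third true v)

-- Boolean polynomials

infixl 6 _⊻_

_⊻_ : Subset d → Subset d → Subset d
(S ⊻ T) x = S x xor T x

-- Boolean functions of degree < r as polynomials: S = S₀ + x₁ (S₀ + S₁) in the first coordinate x₁.
data Deg< : ℕ → (d : ℕ) → Subset d → Set where
  null : (∀ x → S x ≡ false) → Deg< 0 d S
  const : Deg< (suc r) 0 S
  split : Deg< (suc r) d (lo S) → Deg< r d (lo S ⊻ hi S) → Deg< (suc r) (suc d) S

Deg-ext : S ≗ T → Deg< r d S → Deg< r d T
Deg-ext e (null p) = null λ x → trans (sym (e x)) (p x)
Deg-ext e const = const
Deg-ext e (split s t) = split (Deg-ext (e ∘ (false ∷_)) s)
  (Deg-ext (λ x → cong₂ _xor_ (e (false ∷ x)) (e (true ∷ x))) t)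

module _ where
  open xor-∧-Solver

  xor-interchange : ∀ a b c e → (a xor b) xor (c xor e) ≡ (a xor c) xor (b xor e)
  xor-interchange = solve 4 (λ a b c e → (a :+ b) :+ (c :+ e) := (a :+ c) :+ (b :+ e)) refl

  xor-cross : ∀ a b c e → (a xor b) xor (c xor e) ≡ (a xor e) xor (b xor c)
  xor-cross = solve 4 (λ a b c e → (a :+ b) :+ (c :+ e) := (a :+ e) :+ (b :+ c)) refl

  xor-chain : ∀ a b c → (a xor b) xor (b xor c) ≡ a xor c
  xor-chain = solve 3 (λ a b c → (a :+ b) :+ (b :+ c) := a :+ c) refl

  xor-cancelˡ : ∀ a b → a xor (a xor b) ≡ b
  xor-cancelˡ = solve 2 (λ a b → a :+ (a :+ b) := b) refl

xor-false : ∀ a b → a xor b ≡ false → a ≡ b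
xor-false false false _ = refl
xor-false true true _ = refl

Deg-xor : Deg< r d S → Deg< r d T → Deg< r d (S ⊻ T)
Deg-xor (null p) (null q) = null λ x → cong₂ _xor_ (p x) (q x)
Deg-xor const const = const
Deg-xor {S = S} {T = T} (split s t) (split s′ t′) = split (Deg-xor s s′)
  (Deg-ext (λ x → xor-interchange (lo S x) (hi S x) (lo T x) (hi T x)) (Deg-xor t t′))

Deg-false : Deg< r d (λ _ → false)
Deg-false {zero} = null λ _ → refl
Deg-false {suc r} {zero} = const
Deg-false {suc r} {suc d} = split Deg-false Deg-false

Deg-const : ∀ β → Deg< (suc r) d (λ _ → β)
Deg-const {d = zero} β = const
Deg-const {d = suc d} β = split (Deg-const β) (Deg-ext (λ _ → sym (Bool.xor-same β)) Deg-false)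

Deg-suc : Deg< r d S → Deg< (suc r) d S
Deg-suc (null p) = Deg-ext (λ x → sym (p x)) Deg-false
Deg-suc const = const
Deg-suc (split s t) = split (Deg-suc s) (Deg-suc t)

Deg-mono : ∀ {r s} → r ℕ.≤ s → Deg< r d S → Deg< s d S
Deg-mono r≤s = go (ℕ.≤⇒≤′ r≤s)
  where
  go : ∀ {r s} → r ℕ.≤′ s → Deg< r d S → Deg< s d S
  go ℕ.≤′-refl q = q
  go (ℕ.≤′-step p) q = Deg-suc (go p q)

Deg-total : Deg< (suc d) d S
Deg-total {zero} = const
Deg-total {suc d} = split (Deg-suc Deg-total) Deg-total

-- `split` extended to r = 0 by the truncated predecessor, so that the derivative rules treat the
-- zero function uniformly.
Deg-join : Deg< r d (lo S) → Deg< (pred r) d (lo S ⊻ hi S) → Deg< r (suc d) S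
Deg-join {S = S} (null p) (null q) = null (by-halves p λ x → trans (cong (_xor hi S x) (sym (p x))) (q x))
Deg-join {suc r} s t = split s t

Deg-lo : Deg< r (suc d) S → Deg< r d (lo S)
Deg-lo (null p) = null (p ∘ (false ∷_))
Deg-lo (split s t) = s

Deg-diff : Deg< r (suc d) S → Deg< (pred r) d (lo S ⊻ hi S)
Deg-diff (null p) = null λ x → cong₂ _xor_ (p (false ∷ x)) (p (true ∷ x))
Deg-diff (split s t) = t

∂ : Ω d → Subset d → Subset d
∂ b S = S ⊻ shift b S

-- The induction is mutual. For a direction (1, b) the lower half of the derivative is S₀(x) + S₁(x
-- + b) = ∂_b S₀ (x) + (S₀ + S₁)(x + b), which involves a shift of S₀ + S₁, already of smaller
-- degree; a shift in turn is S + ∂_b S.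
Deg-∂ : ∀ b → Deg< r d S → Deg< (pred r) d (∂ b S)
Deg-shift : ∀ b → Deg< r d S → Deg< r d (shift b S)

Deg-∂ {S = S} [] q = Deg-ext (λ { [] → sym (Bool.xor-same (S [])) }) Deg-false
Deg-∂ {S = S} (false ∷ b) q = Deg-join (Deg-∂ b (Deg-lo q))
  (Deg-ext (λ x → xor-interchange (lo S x) (hi S x) (lo S (x ⊕ b)) (hi S (x ⊕ b))) (Deg-∂ b (Deg-diff q)))
Deg-∂ {S = S} (true ∷ b) q = Deg-join
  (Deg-ext (λ x → xor-chain (lo S x) (lo S (x ⊕ b)) (hi S (x ⊕ b)))
    (Deg-xor (Deg-∂ b (Deg-lo q)) (Deg-shift b (Deg-diff q))))
  (Deg-ext (λ x → xor-cross (lo S x) (hi S x) (lo S (x ⊕ b)) (hi S (x ⊕ b))) (Deg-∂ b (Deg-diff q)))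

Deg-shift {r} {S = S} b q = Deg-ext (λ x → xor-cancelˡ (S x) (S (x ⊕ b)))
  (Deg-xor q (Deg-mono ℕ.pred[n]≤n (Deg-∂ b q)))

Deg-hi : Deg< r (suc d) S → Deg< r d (hi S)
Deg-hi {S = S} q = Deg-ext (λ x → xor-cancelˡ (lo S x) (hi S x))
  (Deg-xor (Deg-lo q) (Deg-mono ℕ.pred[n]≤n (Deg-diff q)))

Deg<1-constant : Deg< 1 d S → ∃ λ β → ∀ x → S x ≡ β
Deg<1-constant {S = S} const = S [] , λ { [] → refl }
Deg<1-constant {S = S} (split s (null p)) with Deg<1-constant s
... | β , e = β , by-halves e λ x → trans (sym (xor-false (lo S x) (hi S x) (p x))) (e x)

-- Sign changes of degree 0, 1 and 2 acting on the lattices.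

signed-xor : ∀ s t a → signed (s xor t) a ≡ signed s (signed t a)
signed-xor false t a = refl
signed-xor true false a = refl
signed-xor true true a = sym (ℤ.neg-involutive a)

signed-*ˡ : ∀ s a b → signed s (a ℤ.* b) ≡ signed s a ℤ.* b
signed-*ˡ false a b = refl
signed-*ˡ true a b = ℤ.neg-distribˡ-* a b

-- A constant sign leaves the difference 0 or 2 X. The gain of two steps is what compensates, in the
-- affine case, for the halves of X lying one step lower than X.
Λ-twist-fix₀ : Deg< 1 d T → Λ k d X → Λ (2 ℕ.+ k) d (X ⊟ twist T X)
Λ-twist-fix₀ {X = X} t a with Deg<1-constant t
... | false , e = Λ-ext (λ x → sym (trans (cong (λ β → X x ℤ.- signed β (X x)) (e x)) (ℤ.+-inverseʳ (X x)))) Λ-zero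
... | true , e = Λ-ext (λ x → sym (trans (cong (λ β → X x ℤ.- signed β (X x)) (e x))
    (cong (λ z → X x ℤ.+ z) (ℤ.neg-involutive (X x))))) (Λ-double {X = X} a)

recover : ∀ a b → (a ℤ.- b) ℤ.+ b ≡ a
recover = solve-∀

-- With w = lo X - hi X, the half difference of (ε_S - 1) X is (ε_{S₀} - 1) w + ε_{S₀} (1 -
-- ε_{S₀+S₁}) hi X. The first term rises by induction. In the second, S₀ + S₁ is constant, so `hi X`
-- rises two steps, and ε_{S₀} keeps it there.
Λ-twist-fix₁ : Deg< 2 d S → Λ k d X → Λ (suc k) d (twist S X ⊟ X)
Λ-twist-fix₁ {zero} {S} {X = X} const a =
  Λ-ext (λ x → neg-sub (X x) (signed (S x) (X x))) (Λ-neg (Λ-down (Λ-twist-fix₀ {T = S} const a)))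
Λ-twist-fix₁ {suc d} {S} {X = X} q@(split s t) a = go a
  where
  hi-gap : ∀ {k} → Λ k (suc d) X → Λ (suc k) d (hi X ⊟ twist (lo S ⊻ hi S) (hi X))
  hi-gap free = Λ-down (Λ-twist-fix₀ {X = hi X} t free)
  hi-gap (node _ b _) = Λ-twist-fix₀ t b
  lo-twist : ∀ {k Y} → Λ (suc k) d Y → Λ (suc k) d (twist (lo S) Y)
  lo-twist {Y = Y} u = Λ-ext (λ x → recover (signed (lo S x) (Y x)) (Y x))
    (Λ-add (Λ-down (Λ-twist-fix₁ s u)) u)
  third : ∀ {k} → Λ k (suc d) X → Λ (suc k) d (lo (twist S X ⊟ X) ⊟ hi (twist S X ⊟ X))
  third a = Λ-ext (λ x → lem (lo S x) (hi S x) (lo X x) (hi X x))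
      (Λ-add (Λ-twist-fix₁ s (Λ-diff a)) (lo-twist (hi-gap a)))
    where
    lem : ∀ s t a b → (signed s (a ℤ.- b) ℤ.- (a ℤ.- b)) ℤ.+ signed s (b ℤ.- signed (s xor t) b)
      ≡ (signed s a ℤ.- a) ℤ.- (signed t b ℤ.- b)
    lem false false = ff
      where
      ff : ∀ a b → ((a ℤ.- b) ℤ.- (a ℤ.- b)) ℤ.+ (b ℤ.- b) ≡ (a ℤ.- a) ℤ.- (b ℤ.- b)
      ff = solve-∀
    lem false true = ft
      where
      ft : ∀ a b → ((a ℤ.- b) ℤ.- (a ℤ.- b)) ℤ.+ (b ℤ.- (ℤ.- b)) ≡ (a ℤ.- a) ℤ.- ((ℤ.- b) ℤ.- b)
      ft = solve-∀
    lem true false = tf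
      where
      tf : ∀ a b → (ℤ.- (a ℤ.- b) ℤ.- (a ℤ.- b)) ℤ.+ (ℤ.- (b ℤ.- (ℤ.- b))) ≡ ((ℤ.- a) ℤ.- a) ℤ.- (b ℤ.- b)
      tf = solve-∀
    lem true true = tt
      where
      tt : ∀ a b → (ℤ.- (a ℤ.- b) ℤ.- (a ℤ.- b)) ℤ.+ (ℤ.- (b ℤ.- b)) ≡ ((ℤ.- a) ℤ.- a) ℤ.- ((ℤ.- b) ℤ.- b)
      tt = solve-∀
  go : ∀ {k} → Λ k (suc d) X → Λ (suc k) (suc d) (twist S X ⊟ X)
  go free = node free free (third free)
  go v@(node a b _) = node (Λ-twist-fix₁ s a) (Λ-twist-fix₁ (Deg-hi q) b) (third v)

-- The new half difference is ε_{S₀} (w - (ε_{S₀+S₁} - 1) hi X). For quadratic S the function S₀ +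
-- S₁ is affine, so (ε_{S₀+S₁} - 1) lifts `hi X` by exactly the one step that separates it from w.
Λ-twist : Deg< 3 d S → Λ k d X → Λ k d (twist S X)
Λ-twist q free = free
Λ-twist {zero} {S} {X = X} q v@(leaf _ _) = Λ-ext (λ { [] → refl }) (Λ-signed (S []) v)
Λ-twist {suc d} {S} {X = X} q (node a b w) = node (Λ-twist (Deg-lo q) a) (Λ-twist (Deg-hi q) b)
    (Λ-ext (λ x → lem (lo S x) (hi S x) (lo X x) (hi X x))
      (Λ-twist (Deg-lo q) (Λ-sub w (Λ-twist-fix₁ (Deg-diff q) b))))
  where
  lem : ∀ s t a b → signed s ((a ℤ.- b) ℤ.- (signed (s xor t) b ℤ.- b)) ≡ signed s a ℤ.- signed t b
  lem false false = ff
    where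
    ff : ∀ a b → ((a ℤ.- b) ℤ.- (b ℤ.- b)) ≡ a ℤ.- b
    ff = solve-∀
  lem false true = ft
    where
    ft : ∀ a b → ((a ℤ.- b) ℤ.- ((ℤ.- b) ℤ.- b)) ≡ a ℤ.- (ℤ.- b)
    ft = solve-∀
  lem true false = tf
    where
    tf : ∀ a b → ℤ.- ((a ℤ.- b) ℤ.- ((ℤ.- b) ℤ.- b)) ≡ (ℤ.- a) ℤ.- b
    tf = solve-∀
  lem true true = tt
    where
    tt : ∀ a b → ℤ.- ((a ℤ.- b) ℤ.- (b ℤ.- b)) ≡ (ℤ.- a) ℤ.- (ℤ.- b)
    tt = solve-∀

-- Minimal norm and congruent minimal vectors

sumΩ : Fn d → ℤ
sumΩ {zero} X = X []
sumΩ {suc d} X = sumΩ (lo X) ℤ.+ sumΩ (hi X)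

⟨_,_⟩ : Fn d → Fn d → ℤ
⟨ X , Y ⟩ = sumΩ (λ x → X x ℤ.* Y x)

N : Fn d → ℤ
N X = ⟨ X , X ⟩

sumΩ-cong : X ≗ Y → sumΩ X ≡ sumΩ Y
sumΩ-cong {zero} e = e []
sumΩ-cong {suc d} e = cong₂ ℤ._+_ (sumΩ-cong (e ∘ (false ∷_))) (sumΩ-cong (e ∘ (true ∷_)))

N-cong : X ≗ Y → N X ≡ N Y
N-cong e = sumΩ-cong λ x → cong₂ ℤ._*_ (e x) (e x)

sumΩ-neg : ∀ {d} (X : Fn d) → sumΩ (λ x → ℤ.- X x) ≡ ℤ.- sumΩ X
sumΩ-neg {zero} X = refl
sumΩ-neg {suc d} X = trans (cong₂ ℤ._+_ (sumΩ-neg (lo X)) (sumΩ-neg (hi X)))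
  (sym (ℤ.neg-distrib-+ (sumΩ (lo X)) (sumΩ (hi X))))

sumΩ-zero : ∀ {d} → sumΩ {d} (λ _ → 0ℤ) ≡ 0ℤ
sumΩ-zero {zero} = refl
sumΩ-zero {suc d} = cong₂ ℤ._+_ (sumΩ-zero {d}) (sumΩ-zero {d})

sumΩ-shift : ∀ c (X : Fn d) → sumΩ (shift c X) ≡ sumΩ X
sumΩ-shift [] X = refl
sumΩ-shift (false ∷ c) X = cong₂ ℤ._+_ (sumΩ-shift c (lo X)) (sumΩ-shift c (hi X))
sumΩ-shift (true ∷ c) X = trans (cong₂ ℤ._+_ (sumΩ-shift c (hi X)) (sumΩ-shift c (lo X)))
  (ℤ.+-comm (sumΩ (hi X)) (sumΩ (lo X)))

sumΩ-mono : (∀ x → X x ℤ.≤ Y x) → sumΩ X ℤ.≤ sumΩ Y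
sumΩ-mono {zero} e = e []
sumΩ-mono {suc d} e = ℤ.+-mono-≤ (sumΩ-mono (e ∘ (false ∷_))) (sumΩ-mono (e ∘ (true ∷_)))

square : ∀ c → c ℤ.* c ≡ + (ℤ.∣ c ∣ ℕ.* ℤ.∣ c ∣)
square (+ n) = sym (ℤ.pos-* n n)
square ℤ.-[1+ n ] = refl

0≤N : ∀ {d} (X : Fn d) → 0ℤ ℤ.≤ N X
0≤N {d} X = ℤ.≤-trans (ℤ.≤-reflexive (sym (sumΩ-zero {d})))
  (sumΩ-mono λ x → subst (0ℤ ℤ.≤_) (sym (square (X x))) (ℤ.+≤+ z≤n))

N-sub : ∀ {d} (X Y : Fn d) → N (X ⊟ Y) ℤ.+ (⟨ X , Y ⟩ ℤ.+ ⟨ X , Y ⟩) ≡ N X ℤ.+ N Y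
N-sub {zero} X Y = lem (X []) (Y [])
  where
  lem : ∀ a b → (a ℤ.- b) ℤ.* (a ℤ.- b) ℤ.+ (a ℤ.* b ℤ.+ a ℤ.* b) ≡ a ℤ.* a ℤ.+ b ℤ.* b
  lem = solve-∀
N-sub {suc d} X Y = begin
    (p ℤ.+ q) ℤ.+ ((u ℤ.+ v) ℤ.+ (u ℤ.+ v))   ≡⟨ lem p q u v ⟩
    (p ℤ.+ (u ℤ.+ u)) ℤ.+ (q ℤ.+ (v ℤ.+ v))   ≡⟨ cong₂ ℤ._+_ (N-sub (lo X) (lo Y)) (N-sub (hi X) (hi Y)) ⟩
    (N (lo X) ℤ.+ N (lo Y)) ℤ.+ (N (hi X) ℤ.+ N (hi Y)) ≡⟨ swap (N (lo X)) (N (lo Y)) (N (hi X)) (N (hi Y)) ⟩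
    N X ℤ.+ N Y ∎
  where
  open ≡-Reasoning
  p = N (lo X ⊟ lo Y)
  q = N (hi X ⊟ hi Y)
  u = ⟨ lo X , lo Y ⟩
  v = ⟨ hi X , hi Y ⟩
  lem : ∀ p q r s → (p ℤ.+ q) ℤ.+ ((r ℤ.+ s) ℤ.+ (r ℤ.+ s)) ≡ (p ℤ.+ (r ℤ.+ r)) ℤ.+ (q ℤ.+ (s ℤ.+ s))
  lem = solve-∀
  swap : ∀ a b c e → (a ℤ.+ b) ℤ.+ (c ℤ.+ e) ≡ (a ℤ.+ c) ℤ.+ (b ℤ.+ e)
  swap = solve-∀

⟨⟩-negʳ : ∀ {d} (X Y : Fn d) → ⟨ X , (λ x → ℤ.- Y x) ⟩ ≡ ℤ.- ⟨ X , Y ⟩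
⟨⟩-negʳ X Y = trans (sumΩ-cong λ x → sym (ℤ.neg-distribʳ-* (X x) (Y x))) (sumΩ-neg (λ x → X x ℤ.* Y x))

N-signed : ∀ (S : Subset d) (X : Fn d) → N (twist S X) ≡ N X
N-signed S X = sumΩ-cong λ x → lem (S x) (X x)
  where
  neg : ∀ a → (ℤ.- a) ℤ.* (ℤ.- a) ≡ a ℤ.* a
  neg = solve-∀
  lem : ∀ s a → signed s a ℤ.* signed s a ≡ a ℤ.* a
  lem false a = refl
  lem true a = neg a

zero? : (X : Fn d) → (∀ x → X x ≡ 0ℤ) ⊎ (∃ λ x → X x ≢ 0ℤ)
zero? {zero} X with X [] ℤ.≟ 0ℤ
... | yes p = inj₁ λ { [] → p }
... | no p = inj₂ ([] , p)
zero? {suc d} X with zero? (lo X) | zero? (hi X)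
... | inj₁ p | inj₁ q = inj₁ (by-halves p q)
... | inj₂ (x , p) | _ = inj₂ (false ∷ x , p)
... | inj₁ _ | inj₂ (x , p) = inj₂ (true ∷ x , p)

N-zero : (∀ x → X x ≡ 0ℤ) → N X ≡ 0ℤ
N-zero {d} p = trans (N-cong p) (sumΩ-zero {d})

-- The node rule puts `lo X` itself only into the previous lattice; here `lo X` equals the half
-- difference, which has the full index k.
Λ-lo : (∀ x → hi X x ≡ 0ℤ) → Λ k (suc d) X → Λ k d (lo X)
Λ-lo p free = free
Λ-lo {X = X} p (node _ _ s) = Λ-ext (λ x → trans (cong (λ z → lo X x ℤ.- z) (p x)) (ℤ.+-identityʳ (lo X x))) s

Λ-hi : (∀ x → lo X x ≡ 0ℤ) → Λ k (suc d) X → Λ k d (hi X)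
Λ-hi p free = free
Λ-hi {X = X} p (node _ _ s) = Λ-ext
  (λ x → trans (neg-sub (lo X x) (hi X x)) (trans (cong (λ z → hi X x ℤ.- z) (p x)) (ℤ.+-identityʳ (hi X x))))
  (Λ-neg s)

2^k≤2^⌈k/2⌉² : ∀ k → 2 ℕ.^ k ℕ.≤ 2 ℕ.^ ⌈ k /2⌉ ℕ.* 2 ℕ.^ ⌈ k /2⌉
2^k≤2^⌈k/2⌉² k = begin
    2 ℕ.^ k                               ≡⟨ cong (2 ℕ.^_) (sym (ℕ.⌊n/2⌋+⌈n/2⌉≡n k)) ⟩
    2 ℕ.^ (⌊ k /2⌋ ℕ.+ ⌈ k /2⌉)           ≤⟨ ℕ.^-monoʳ-≤ 2 (ℕ.+-monoˡ-≤ ⌈ k /2⌉ (ℕ.⌊n/2⌋≤⌈n/2⌉ k)) ⟩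
    2 ℕ.^ (⌈ k /2⌉ ℕ.+ ⌈ k /2⌉)           ≡⟨ ℕ.^-distribˡ-+-* 2 ⌈ k /2⌉ ⌈ k /2⌉ ⟩
    2 ℕ.^ ⌈ k /2⌉ ℕ.* 2 ℕ.^ ⌈ k /2⌉       ∎
  where open ℕ.≤-Reasoning

square-leaf : ∀ m c → (+ m ℤ.* c) ℤ.* (+ m ℤ.* c) ≡ + (m ℕ.* m ℕ.* (ℤ.∣ c ∣ ℕ.* ℤ.∣ c ∣))
square-leaf m c = begin
    (+ m ℤ.* c) ℤ.* (+ m ℤ.* c)                      ≡⟨ lem (+ m) c ⟩
    (+ m ℤ.* + m) ℤ.* (c ℤ.* c)                      ≡⟨ cong₂ ℤ._*_ (square (+ m)) (square c) ⟩
    + (m ℕ.* m) ℤ.* + (ℤ.∣ c ∣ ℕ.* ℤ.∣ c ∣)          ≡⟨ sym (ℤ.pos-* (m ℕ.* m) _) ⟩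
    + (m ℕ.* m ℕ.* (ℤ.∣ c ∣ ℕ.* ℤ.∣ c ∣))            ∎
  where
  open ≡-Reasoning
  lem : ∀ m c → (m ℤ.* c) ℤ.* (m ℤ.* c) ≡ (m ℤ.* m) ℤ.* (c ℤ.* c)
  lem = solve-∀

1≤∣c∣² : ∀ c → c ≢ 0ℤ → 1 ℕ.≤ ℤ.∣ c ∣ ℕ.* ℤ.∣ c ∣
1≤∣c∣² (+ zero) c≢0 = contradiction refl c≢0
1≤∣c∣² (+ suc n) _ = s≤s z≤n
1≤∣c∣² ℤ.-[1+ n ] _ = s≤s z≤n

2^suc : ∀ k → + (2 ℕ.^ suc k) ≡ + (2 ℕ.^ k) ℤ.+ + (2 ℕ.^ k)
2^suc k = cong (λ z → + (2 ℕ.^ k ℕ.+ z)) (ℕ.+-identityʳ (2 ℕ.^ k))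

-- Two nonzero halves contribute 2^(k-1) each; a single nonzero half lies in the lattice of index k
-- by `Λ-lo` or `Λ-hi` and contributes 2^k alone. On a point, (2^⌈k/2⌉)² ≥ 2^k.
Λ-min : Λ k d X → ∃ (λ x → X x ≢ 0ℤ) → + (2 ℕ.^ k) ℤ.≤ N X
Λ-min {d = zero} {X} free ([] , p) = subst (1ℤ ℤ.≤_) (sym (square (X []))) (ℤ.+≤+ (1≤∣c∣² (X []) p))
Λ-min {d = zero} {X} (leaf {k} c e) ([] , p) =
    subst (+ (2 ℕ.^ suc k) ℤ.≤_) (sym (trans (cong (λ z → z ℤ.* z) e) (square-leaf m c))) (ℤ.+≤+ (begin
      2 ℕ.^ suc k                              ≤⟨ 2^k≤2^⌈k/2⌉² (suc k) ⟩
      m ℕ.* m                                  ≡⟨ sym (ℕ.*-identityʳ (m ℕ.* m)) ⟩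
      m ℕ.* m ℕ.* 1                            ≤⟨ ℕ.*-monoʳ-≤ (m ℕ.* m) (1≤∣c∣² c c≢0) ⟩
      m ℕ.* m ℕ.* (ℤ.∣ c ∣ ℕ.* ℤ.∣ c ∣)        ∎))
  where
  open ℕ.≤-Reasoning
  m = 2 ℕ.^ ⌈ suc k /2⌉
  c≢0 : c ≢ 0ℤ
  c≢0 refl = p (trans e (ℤ.*-zeroʳ (+ m)))
Λ-min {k} {suc d} {X} v nz with zero? (lo X) | zero? (hi X)
... | inj₁ p | inj₁ q = contradiction (by-halves {X = X} {Y = λ _ → 0ℤ} p q (proj₁ nz)) (proj₂ nz)
... | inj₁ p | inj₂ q = ℤ.≤-trans (Λ-min (Λ-hi p v) q)
  (ℤ.≤-trans (ℤ.≤-reflexive (sym (ℤ.+-identityˡ (N (hi X))))) (ℤ.+-monoˡ-≤ (N (hi X)) (0≤N (lo X))))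
... | inj₂ p | inj₁ q = ℤ.≤-trans (Λ-min (Λ-lo q v) p)
  (ℤ.≤-trans (ℤ.≤-reflexive (sym (ℤ.+-identityʳ (N (lo X))))) (ℤ.+-monoʳ-≤ (N (lo X)) (0≤N (hi X))))
... | inj₂ p | inj₂ q = both v
  where
  both : ∀ {k} → Λ k (suc d) X → + (2 ℕ.^ k) ℤ.≤ N X
  both free = ℤ.≤-trans (ℤ.+≤+ (s≤s z≤n)) (ℤ.+-mono-≤ (Λ-min {X = lo X} free p) (Λ-min {X = hi X} free q))
  both (node {k} a b _) = subst (ℤ._≤ N X) (sym (2^suc k)) (ℤ.+-mono-≤ (Λ-min a p) (Λ-min b q))

character : Ω d → Subset d
character [] [] = false
character (l ∷ ls) (x ∷ xs) = (l ∧ x) xor character ls xs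

character-Deg : ∀ (l : Ω d) → Deg< 2 d (character l)
character-Deg [] = const
character-Deg (l ∷ ls) = split (Deg-ext (λ x → cong (_xor character ls x) (sym (Bool.∧-zeroʳ l))) (character-Deg ls))
  (Deg-ext (λ x → lem l (character ls x)) (Deg-const l))
  where
  lem : ∀ l c → l ≡ ((l ∧ false) xor c) xor ((l ∧ true) xor c)
  lem false false = refl
  lem false true = refl
  lem true false = refl
  lem true true = refl

i+i≡0⇒i≡0 : ∀ i → i ℤ.+ i ≡ 0ℤ → i ≡ 0ℤ
i+i≡0⇒i≡0 (+ zero) _ = refl

-- Injectivity of the Walsh-Hadamard transform, one coordinate at a time: the coefficients at (0, l)
-- and (1, l) are A + B and A - B for the coefficients A, B of the two halves, so 2A = 2B = 0.
fourier : (X : Fn d) → (∀ l → sumΩ (twist (character l) X) ≡ 0ℤ) → ∀ x → X x ≡ 0ℤ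
fourier {zero} X p [] = p []
fourier {suc d} X p = by-halves (fourier (lo X) λ l → i+i≡0⇒i≡0 _ (u l)) (fourier (hi X) λ l → i+i≡0⇒i≡0 _ (v l))
  where
  A B : Ω d → ℤ
  A l = sumΩ (twist (character l) (lo X))
  B l = sumΩ (twist (character l) (hi X))
  minus : ∀ l → A l ℤ.- B l ≡ 0ℤ
  minus l = trans (cong (λ z → A l ℤ.+ z) (sym (trans
    (sumΩ-cong λ x → signed-xor true (character l x) (hi X x)) (sumΩ-neg (twist (character l) (hi X)))))) (p (true ∷ l))
  sum+ : ∀ a b → a ℤ.+ a ≡ (a ℤ.+ b) ℤ.+ (a ℤ.- b)
  sum+ = solve-∀
  sum- : ∀ a b → b ℤ.+ b ≡ (a ℤ.+ b) ℤ.- (a ℤ.- b)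
  sum- = solve-∀
  u : ∀ l → A l ℤ.+ A l ≡ 0ℤ
  u l = trans (sum+ (A l) (B l)) (cong₂ ℤ._+_ (p (false ∷ l)) (minus l))
  v : ∀ l → B l ℤ.+ B l ≡ 0ℤ
  v l = trans (sum- (A l) (B l)) (cong₂ ℤ._-_ (p (false ∷ l)) (minus l))

-- Finite search replaces the classical step "some frame vector is ± Y, or all are orthogonal to Y".
search : ∀ {P Q : Ω d → Set} → (∀ l → P l ⊎ Q l) → ∃ P ⊎ (∀ l → Q l)
search {zero} f with f []
... | inj₁ p = inj₁ ([] , p)
... | inj₂ q = inj₂ λ { [] → q }
search {suc d} f with search (f ∘ (false ∷_)) | search (f ∘ (true ∷_))
... | inj₁ (l , p) | _ = inj₁ (false ∷ l , p)
... | inj₂ _ | inj₁ (l , p) = inj₁ (true ∷ l , p)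
... | inj₂ p | inj₂ q = inj₂ λ { (false ∷ l) → p l ; (true ∷ l) → q l }

+-cancelˡ-≤ : ∀ a {b c} → a ℤ.+ b ℤ.≤ a ℤ.+ c → b ℤ.≤ c
+-cancelˡ-≤ a {b} {c} p = subst₂ ℤ._≤_ (lem a b) (lem a c) (ℤ.+-monoʳ-≤ (ℤ.- a) p)
  where
  lem : ∀ a b → ℤ.- a ℤ.+ (a ℤ.+ b) ≡ b
  lem = solve-∀

-- Unless X - Y vanishes, its norm is at least 2^(k+1) = N X + N Y, and polarisation turns this into
-- 2⟨X , Y⟩ ≤ 0.
Λ-separated : Λ (suc k) d (X ⊟ Y) → N X ≡ + (2 ℕ.^ k) → N Y ≡ + (2 ℕ.^ k) → Y ≗ X ⊎ ⟨ X , Y ⟩ ℤ.+ ⟨ X , Y ⟩ ℤ.≤ 0ℤ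
Λ-separated {k} {X = X} {Y} v p q with zero? (X ⊟ Y)
... | inj₁ e = inj₁ λ x → sym (ℤ.i-j≡0⇒i≡j (X x) (Y x) (e x))
... | inj₂ nz = inj₂ (+-cancelˡ-≤ (N (X ⊟ Y)) (begin
    N (X ⊟ Y) ℤ.+ (⟨ X , Y ⟩ ℤ.+ ⟨ X , Y ⟩)   ≡⟨ N-sub X Y ⟩
    N X ℤ.+ N Y                               ≡⟨ cong₂ ℤ._+_ p q ⟩
    + (2 ℕ.^ k) ℤ.+ + (2 ℕ.^ k)               ≡⟨ sym (2^suc k) ⟩
    + (2 ℕ.^ suc k)                           ≤⟨ Λ-min v nz ⟩
    N (X ⊟ Y)                                 ≡⟨ sym (ℤ.+-identityʳ _) ⟩
    N (X ⊟ Y) ℤ.+ 0ℤ                          ∎))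
  where open ℤ.≤-Reasoning

-- Both X − Y and X + Y lie in Λ (k + 1), so each is zero or of norm at least 2 ^ (k + 1); the latter
-- bounds ⟨ X , Y ⟩ from above and below by 0.
Λ-frame : Λ k d Y → Λ (suc k) d (X ⊟ Y) → N X ≡ + (2 ℕ.^ k) → N Y ≡ + (2 ℕ.^ k) →
  (∃ λ β → ∀ x → Y x ≡ signed β (X x)) ⊎ ⟨ X , Y ⟩ ≡ 0ℤ
Λ-frame {k} {Y = Y} {X} b v p q with Λ-separated v p q
  | Λ-separated {X = X} {Y = λ x → ℤ.- Y x} (Λ-ext (λ x → lem (X x) (Y x)) (Λ-add v (Λ-down (Λ-double {X = Y} b))))
      p (trans (N-signed (λ _ → true) Y) q)
  where
  lem : ∀ a b → (a ℤ.- b) ℤ.+ (b ℤ.+ b) ≡ a ℤ.- (ℤ.- b)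
  lem = solve-∀
... | inj₁ e | _ = inj₁ (false , e)
... | inj₂ _ | inj₁ e = inj₁ (true , λ x → trans (sym (ℤ.neg-involutive (Y x))) (cong ℤ.-_ (e x)))
... | inj₂ s | inj₂ t = inj₂ (i+i≡0⇒i≡0 D (ℤ.≤-antisym s (subst (0ℤ ℤ.≤_) (lem D)
      (ℤ.neg-mono-≤ (subst (λ z → z ℤ.+ z ℤ.≤ 0ℤ) (⟨⟩-negʳ X Y) t)))))
  where
  D = ⟨ X , Y ⟩
  lem : ∀ a → ℤ.- (ℤ.- a ℤ.+ (ℤ.- a)) ≡ a ℤ.+ a
  lem = solve-∀

N-nonzero : N X ≡ + (2 ℕ.^ k) → ∃ λ x → X x ≢ 0ℤ
N-nonzero {X = X} {k} p with zero? X
... | inj₂ nz = nz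
... | inj₁ z = contradiction (ℤ.+-injective (trans (sym p) (N-zero z))) (ℕ.≢-nonZero⁻¹ _ {{ℕ.m^n≢0 2 k}})

-- The images of X under translations and linear characters are an orthogonal frame in the class of
-- X modulo Λ (k + 1): Y lies in that class, so it is ± a frame vector.
Λ-congruent : Λ k d X → Λ k d Y → Λ (suc k) d (X ⊟ Y) → N X ≡ + (2 ℕ.^ k) → N Y ≡ + (2 ℕ.^ k) →
  ∃ λ c → ∃ λ U → Deg< 2 d U × (∀ x → Y x ≡ signed (U x) (X (x ⊕ c)))
Λ-congruent {k} {d} {X} {Y} a b v p q with N-nonzero {k = k} p | N-nonzero {k = k} q
... | x , Xx≢0 | y , Yy≢0 = [ found , (λ o → ⊥-elim (absurd o)) ]′ (search test)
  where
  -- This translation carries a support point of X to a support point of Y, so X′ y = X x ≠ 0 and X′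
  -- · Y is not identically zero. With c fixed, only the characters have to be searched.
  c = x ⊕ y
  X′ = shift c X
  Z : Ω d → Fn d
  Z l = twist (character l) X′
  a′ : Λ k d X′
  a′ = Λ-ext (λ x → recover (X′ x) (X x)) (Λ-add (Λ-down (Λ-shift-fix c a)) a)
  congr : ∀ l → Λ (suc k) d (Z l ⊟ Y)
  congr l = Λ-ext (λ x → chain (Z l x) (X x) (Y x)) (Λ-add
    (Λ-ext (λ x → chain (Z l x) (X′ x) (X x))
      (Λ-add (Λ-twist-fix₁ (character-Deg l) a′) (Λ-shift-fix c a))) v)
  norm : ∀ l → N (Z l) ≡ + (2 ℕ.^ k)
  norm l = trans (N-signed (character l) X′) (trans (sumΩ-shift c (λ x → X x ℤ.* X x)) p)
  test : ∀ l → (∃ λ β → ∀ x → Y x ≡ signed β (Z l x)) ⊎ ⟨ Z l , Y ⟩ ≡ 0ℤ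
  test l = Λ-frame b (congr l) (norm l) q
  found : ∃ (λ l → ∃ λ β → ∀ x → Y x ≡ signed β (Z l x)) → _
  found (l , β , e) = c , (λ x → β xor character l x) , Deg-xor (Deg-const β) (character-Deg l)
    , λ x → trans (e x) (sym (signed-xor β (character l x) (X′ x)))
  -- The numbers ⟨ Z l , Y ⟩ are the Walsh-Hadamard coefficients of the pointwise product X′ · Y;
  -- were they all zero, the product would vanish at y.
  absurd : (∀ l → ⟨ Z l , Y ⟩ ≡ 0ℤ) → ⊥
  absurd o = [ (λ z → Xx≢0 (trans (cong X (sym lem)) z)) , Yy≢0 ]′ (ℤ.i*j≡0⇒i≡0∨j≡0 (X′ y) (fourier (λ x → X′ x ℤ.* Y x)
      (λ l → trans (sumΩ-cong λ x → signed-*ˡ (character l x) (X′ x) (Y x)) (o l)) y))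
    where
    lem : y ⊕ (x ⊕ y) ≡ x
    lem = trans (⊕-comm y (x ⊕ y)) (⊕-cancelʳ x y)

-- Indicator functions of flats and Reed–Muller codes

-- `allΩ` interleaves the two halves, so splitting a fold by the first coordinate uses
-- commutativity. Instantiated with xor for indicator functions and with rational addition for the
-- norm.
module Total {B : Set} {_∙_ : B → B → B} {e : B} (cm : IsCommutativeMonoid _≡_ _∙_ e) where
  open IsCommutativeMonoid cm using (assoc; comm; identityˡ)

  total : (Ω d → B) → B
  total {d} f = foldr _∙_ e (map f (allΩ d))

  total-suc : ∀ {d} (f : Ω (suc d) → B) → total f ≡ total (lo f) ∙ total (hi f)
  total-suc {d} f = go (allΩ d)
    where
    open ≡-Reasoning
    go : ∀ xs → foldr _∙_ e (map f (concatMap (λ x → (false ∷ x) ∷ (true ∷ x) ∷ []) xs))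
      ≡ foldr _∙_ e (map (lo f) xs) ∙ foldr _∙_ e (map (hi f) xs)
    go [] = sym (identityˡ e)
    go (x ∷ xs) = begin
        a ∙ (b ∙ _)         ≡⟨ cong (λ z → a ∙ (b ∙ z)) (go xs) ⟩
        a ∙ (b ∙ (p ∙ q))   ≡⟨ cong (a ∙_) (sym (assoc b p q)) ⟩
        a ∙ ((b ∙ p) ∙ q)   ≡⟨ cong (λ z → a ∙ (z ∙ q)) (comm b p) ⟩
        a ∙ ((p ∙ b) ∙ q)   ≡⟨ cong (a ∙_) (assoc p b q) ⟩
        a ∙ (p ∙ (b ∙ q))   ≡⟨ sym (assoc a p (b ∙ q)) ⟩
        (a ∙ p) ∙ (b ∙ q)   ∎
      where
      a = f (false ∷ x)
      b = f (true ∷ x)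
      p = foldr _∙_ e (map (lo f) xs)
      q = foldr _∙_ e (map (hi f) xs)

  total-cong : ∀ {d} {f g : Ω d → B} → f ≗ g → total f ≡ total g
  total-cong {zero} p = cong (_∙ e) (p [])
  total-cong {suc d} {f} {g} p = trans (total-suc f)
    (trans (cong₂ _∙_ (total-cong (p ∘ (false ∷_))) (total-cong (p ∘ (true ∷_)))) (sym (total-suc g)))

open Total (CommutativeRing.+-isCommutativeMonoid Bool.xor-∧-commutativeRing)
  renaming (total to parity; total-suc to parity-suc; total-cong to parity-cong)

eqΩ-shift : ∀ {d} (x b y : Ω d) → eqΩ (x ⊕ b) y ≡ eqΩ x (y ⊕ b)
eqΩ-shift [] [] [] = refl
eqΩ-shift (false ∷ x) (false ∷ b) (false ∷ y) = eqΩ-shift x b y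
eqΩ-shift (false ∷ x) (false ∷ b) (true ∷ y) = refl
eqΩ-shift (false ∷ x) (true ∷ b) (false ∷ y) = refl
eqΩ-shift (false ∷ x) (true ∷ b) (true ∷ y) = eqΩ-shift x b y
eqΩ-shift (true ∷ x) (false ∷ b) (false ∷ y) = refl
eqΩ-shift (true ∷ x) (false ∷ b) (true ∷ y) = eqΩ-shift x b y
eqΩ-shift (true ∷ x) (true ∷ b) (false ∷ y) = eqΩ-shift x b y
eqΩ-shift (true ∷ x) (true ∷ b) (true ∷ y) = refl

eqΩ-sound : ∀ {d} (x y : Ω d) → eqΩ x y ≡ true → x ≡ y
eqΩ-sound [] [] _ = refl
eqΩ-sound (false ∷ x) (false ∷ y) p = cong (false ∷_) (eqΩ-sound x y p)
eqΩ-sound (true ∷ x) (true ∷ y) p = cong (true ∷_) (eqΩ-sound x y p)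

-- As an iterated derivative of the indicator of a point, which has degree d, it has degree d − n.
char : ∀ {n} → Ω d → Vec (Ω d) n → Subset d
char p [] x = eqΩ x p
char p (b ∷ bs) = ∂ b (char p bs)

parity-char : ∀ {n} p (bs : Vec (Ω d) n) x → parity (λ l → eqΩ x (p ⊕ comb l bs)) ≡ char p bs x
parity-char p [] x = trans (Bool.xor-identityʳ _) (cong (eqΩ x) (⊕-identityʳ p))
parity-char p (b ∷ bs) x = trans (parity-suc (λ l → eqΩ x (p ⊕ comb l (b ∷ bs))))
  (cong₂ _xor_ (parity-char p bs x) (trans (parity-cong λ l → sym (begin
    eqΩ (x ⊕ b) (p ⊕ comb l bs)     ≡⟨ eqΩ-shift x b _ ⟩
    eqΩ x ((p ⊕ comb l bs) ⊕ b)     ≡⟨ cong (eqΩ x) (⊕-assoc p _ b) ⟩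
    eqΩ x (p ⊕ (comb l bs ⊕ b))     ≡⟨ cong (λ z → eqΩ x (p ⊕ z)) (⊕-comm _ b) ⟩
    eqΩ x (p ⊕ (b ⊕ comb l bs))     ∎)) (parity-char p bs (x ⊕ b))))
  where open ≡-Reasoning

charA-char : ∀ {n} (A : Affine d n) x → charA A x ≡ char (Affine.base A) (Affine.basis A) x
charA-char A = parity-char (Affine.base A) (Affine.basis A)

char-sound : ∀ {n} p (bs : Vec (Ω d) n) x → char p bs x ≡ true → ∃ λ l → x ≡ p ⊕ comb l bs
char-sound p [] x e = [] , trans (eqΩ-sound x p e) (sym (⊕-identityʳ p))
char-sound p (b ∷ bs) x e with char p bs x in u
... | true with char-sound p bs x u
...   | l , q = false ∷ l , q
char-sound p (b ∷ bs) x e | false with char-sound p bs (x ⊕ b) e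
... | l , q = true ∷ l , (begin
    x                        ≡⟨ sym (⊕-cancelʳ x b) ⟩
    (x ⊕ b) ⊕ b              ≡⟨ cong (_⊕ b) q ⟩
    (p ⊕ comb l bs) ⊕ b      ≡⟨ ⊕-assoc p _ b ⟩
    p ⊕ (comb l bs ⊕ b)      ≡⟨ cong (p ⊕_) (⊕-comm _ b) ⟩
    p ⊕ (b ⊕ comb l bs)      ∎)
  where open ≡-Reasoning

comb-⊕ : ∀ {n} (l m : Vec Bool n) (bs : Vec (Ω d) n) → comb (l ⊕ m) bs ≡ comb l bs ⊕ comb m bs
comb-⊕ [] [] [] = sym (⊕-identityʳ zeroΩ)
comb-⊕ (false ∷ l) (false ∷ m) (b ∷ bs) = comb-⊕ l m bs
comb-⊕ (true ∷ l) (false ∷ m) (b ∷ bs) = trans (cong (b ⊕_) (comb-⊕ l m bs)) (sym (⊕-assoc b _ _))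
comb-⊕ (false ∷ l) (true ∷ m) (b ∷ bs) = begin
    b ⊕ comb (l ⊕ m) bs               ≡⟨ cong (b ⊕_) (comb-⊕ l m bs) ⟩
    b ⊕ (comb l bs ⊕ comb m bs)       ≡⟨ ⊕-comm b _ ⟩
    (comb l bs ⊕ comb m bs) ⊕ b       ≡⟨ ⊕-assoc (comb l bs) _ b ⟩
    comb l bs ⊕ (comb m bs ⊕ b)       ≡⟨ cong (comb l bs ⊕_) (⊕-comm _ b) ⟩
    comb l bs ⊕ (b ⊕ comb m bs)       ∎
  where open ≡-Reasoning
comb-⊕ (true ∷ l) (true ∷ m) (b ∷ bs) = begin
    comb (l ⊕ m) bs                              ≡⟨ comb-⊕ l m bs ⟩
    comb l bs ⊕ comb m bs                        ≡⟨ sym (⊕-cancelʳ _ b) ⟩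
    ((comb l bs ⊕ comb m bs) ⊕ b) ⊕ b            ≡⟨ cong (_⊕ b) (⊕-assoc (comb l bs) _ b) ⟩
    (comb l bs ⊕ (comb m bs ⊕ b)) ⊕ b            ≡⟨ cong (λ z → (comb l bs ⊕ z) ⊕ b) (⊕-comm _ b) ⟩
    (comb l bs ⊕ (b ⊕ comb m bs)) ⊕ b            ≡⟨ ⊕-swapʳ (comb l bs) _ b ⟩
    (comb l bs ⊕ b) ⊕ (b ⊕ comb m bs)            ≡⟨ cong (_⊕ (b ⊕ comb m bs)) (⊕-comm _ b) ⟩
    (b ⊕ comb l bs) ⊕ (b ⊕ comb m bs)            ∎
  where open ≡-Reasoning

Independent : ∀ {n} → Vec (Ω d) n → Set
Independent {n = n} bs = ∀ (l : Vec Bool n) → comb l bs ≡ zeroΩ → l ≡ replicate n false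

Independent-tail : ∀ {n b} {bs : Vec (Ω d) n} → Independent (b ∷ bs) → Independent bs
Independent-tail ind l p = Vec.∷-injectiveʳ (ind (false ∷ l) p)

-- If x and x + b both lie on the flat, b is a combination of `bs`. Disjointness lets the xor in
-- `char` be read as an integer sum.
char-disjoint : ∀ {n b} p (bs : Vec (Ω d) n) → Independent (b ∷ bs) →
  ∀ x → char p bs x ≡ true → char p bs (x ⊕ b) ≡ true → ⊥
char-disjoint {b = b} p bs ind x u v with char-sound p bs x u | char-sound p bs (x ⊕ b) v
... | l , refl | m , q = absurd (ind (true ∷ (l ⊕ m)) (begin
    b ⊕ comb (l ⊕ m) bs               ≡⟨ cong (b ⊕_) (comb-⊕ l m bs) ⟩
    b ⊕ (comb l bs ⊕ comb m bs)       ≡⟨ sym (⊕-assoc b _ _) ⟩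
    (b ⊕ comb l bs) ⊕ comb m bs
      ≡⟨ cong (_⊕ comb m bs) (cancel (trans (cong (p ⊕_) (⊕-comm b _)) (trans (sym (⊕-assoc p _ b)) q))) ⟩
    comb m bs ⊕ comb m bs             ≡⟨ ⊕-self _ ⟩
    zeroΩ                             ∎))
  where
  open ≡-Reasoning
  absurd : ∀ {n} {l : Vec Bool n} → true ∷ l ≢ replicate (suc n) false
  absurd ()
  cancel : ∀ {u v} → p ⊕ u ≡ p ⊕ v → u ≡ v
  cancel {u} {v} e = trans (sym (lem u)) (trans (cong (p ⊕_) e) (lem v))
    where
    lem : ∀ u → p ⊕ (p ⊕ u) ≡ u
    lem u = trans (sym (⊕-assoc p p u)) (trans (cong (_⊕ u) (⊕-self p)) (⊕-identityˡ u))

indicator : Bool → ℤ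
indicator b = if b then 1ℤ else 0ℤ

indicator-xor : ∀ u v → (u ≡ true → v ≡ true → ⊥) → indicator (u xor v) ≡ indicator u ℤ.+ indicator v
indicator-xor false false _ = refl
indicator-xor false true _ = refl
indicator-xor true false _ = refl
indicator-xor true true p = ⊥-elim (p refl refl)

flat : ∀ {n} → Ω d → Vec (Ω d) n → Fn d
flat p bs x = indicator (char p bs x)

flat-cons : ∀ {n b} p (bs : Vec (Ω d) n) → Independent (b ∷ bs) → flat p (b ∷ bs) ≗ flat p bs ⊞ shift b (flat p bs)
flat-cons p bs ind x = indicator-xor _ _ (char-disjoint p bs ind x)

-- A new direction b replaces v by v + shift b v = (shift b v - v) + 2v; the first summand rises one
-- step, the second two.
Λ-flat : ∀ {n} p (bs : Vec (Ω d) n) → Independent bs → Λ n d (flat p bs)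
Λ-flat p [] ind = free
Λ-flat p (b ∷ bs) ind = Λ-ext
    (λ x → trans (lem (flat p bs x) (flat p bs (x ⊕ b))) (sym (flat-cons p bs ind x)))
    (Λ-add (Λ-shift-fix b v) (Λ-down (Λ-double {X = flat p bs} v)))
  where
  v = Λ-flat p bs (Independent-tail ind)
  lem : ∀ a c → (c ℤ.- a) ℤ.+ (a ℤ.+ a) ≡ a ℤ.+ c
  lem = solve-∀

Λ-2^ : ∀ j → Λ k d X → Λ (2 ℕ.* j ℕ.+ k) d (λ x → + (2 ℕ.^ j) ℤ.* X x)
Λ-2^ {X = X} zero v = Λ-ext (λ x → sym (ℤ.*-identityˡ (X x))) v
Λ-2^ {k} {d} {X} (suc j) v = subst (λ n → Λ n d (λ x → + (2 ℕ.^ suc j) ℤ.* X x)) (cong (ℕ._+ k) (sym (ℕ.*-suc 2 j)))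
  (Λ-ext (λ x → trans (sym (ℤ.*-distribʳ-+ (X x) (+ (2 ℕ.^ j)) (+ (2 ℕ.^ j)))) (cong (ℤ._* X x) (sym (2^suc j))))
    (Λ-double {X = λ x → + (2 ℕ.^ j) ℤ.* X x} (Λ-2^ j v)))

sumΩ-add : ∀ {d} (X Y : Fn d) → sumΩ (X ⊞ Y) ≡ sumΩ X ℤ.+ sumΩ Y
sumΩ-add {zero} X Y = refl
sumΩ-add {suc d} X Y = trans (cong₂ ℤ._+_ (sumΩ-add (lo X) (lo Y)) (sumΩ-add (hi X) (hi Y)))
    (lem (sumΩ (lo X)) (sumΩ (lo Y)) (sumΩ (hi X)) (sumΩ (hi Y)))
  where
  lem : ∀ a b c e → (a ℤ.+ b) ℤ.+ (c ℤ.+ e) ≡ (a ℤ.+ c) ℤ.+ (b ℤ.+ e)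
  lem = solve-∀

sumΩ-scale : ∀ {d} a (X : Fn d) → sumΩ (λ x → a ℤ.* X x) ≡ a ℤ.* sumΩ X
sumΩ-scale {zero} a X = refl
sumΩ-scale {suc d} a X = trans (cong₂ ℤ._+_ (sumΩ-scale a (lo X)) (sumΩ-scale a (hi X)))
  (sym (ℤ.*-distribˡ-+ a (sumΩ (lo X)) (sumΩ (hi X))))

sumΩ-point : ∀ (p : Ω d) → sumΩ (λ x → indicator (eqΩ x p)) ≡ 1ℤ
sumΩ-point [] = refl
sumΩ-point {suc d} (false ∷ p) = cong₂ ℤ._+_ (sumΩ-point p) (sumΩ-zero {d})
sumΩ-point {suc d} (true ∷ p) = cong₂ ℤ._+_ (sumΩ-zero {d}) (sumΩ-point p)

sumΩ-flat : ∀ {n} p (bs : Vec (Ω d) n) → Independent bs → sumΩ (flat p bs) ≡ + (2 ℕ.^ n)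
sumΩ-flat p [] ind = sumΩ-point p
sumΩ-flat {n = suc n} p (b ∷ bs) ind = begin
    sumΩ (flat p (b ∷ bs))                              ≡⟨ sumΩ-cong (flat-cons p bs ind) ⟩
    sumΩ (flat p bs ⊞ shift b (flat p bs))              ≡⟨ sumΩ-add (flat p bs) _ ⟩
    sumΩ (flat p bs) ℤ.+ sumΩ (shift b (flat p bs))
      ≡⟨ cong (λ z → sumΩ (flat p bs) ℤ.+ z) (sumΩ-shift b (flat p bs)) ⟩
    sumΩ (flat p bs) ℤ.+ sumΩ (flat p bs)               ≡⟨ cong (λ z → z ℤ.+ z) (sumΩ-flat p bs (Independent-tail ind)) ⟩
    + (2 ℕ.^ n) ℤ.+ + (2 ℕ.^ n)                         ≡⟨ sym (2^suc n) ⟩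
    + (2 ℕ.^ suc n)                                     ∎
  where open ≡-Reasoning

-- Counting points: the flat has 2^n of the 2^d points. This bounds the denominators 2^m of the
-- generators by 2^d.
dim≤ : ∀ {n} → Affine d n → n ℕ.≤ d
dim≤ {d} {n} A = ℕ.≮⇒≥ λ d<n → ℕ.<⇒≱ (ℕ.^-monoʳ-< 2 (s≤s (s≤s z≤n)) d<n) (ℤ.drop‿+≤+ (begin
    + (2 ℕ.^ n)                ≡⟨ sym (sumΩ-flat base basis indep) ⟩
    sumΩ (flat base basis)     ≤⟨ sumΩ-mono (λ x → le (char base basis x)) ⟩
    sumΩ {d} (λ _ → 1ℤ)        ≡⟨ ones d ⟩
    + (2 ℕ.^ d)                ∎))
  where
  open ℤ.≤-Reasoning
  open Affine A
  le : ∀ b → indicator b ℤ.≤ 1ℤ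
  le false = ℤ.+≤+ z≤n
  le true = ℤ.≤-refl
  ones : ∀ d → sumΩ {d} (λ _ → 1ℤ) ≡ + (2 ℕ.^ d)
  ones zero = refl
  ones (suc d) = trans (cong₂ ℤ._+_ (ones d) (ones d)) (sym (2^suc d))

comb-lift : ∀ {n} l (bs : Vec (Ω d) n) → comb l (Vec.map (false ∷_) bs) ≡ false ∷ comb l bs
comb-lift [] [] = refl
comb-lift (false ∷ l) (b ∷ bs) = comb-lift l bs
comb-lift (true ∷ l) (b ∷ bs) = cong ((false ∷ b) ⊕_) (comb-lift l bs)

lift : ∀ {n} → Bool → Affine d n → Affine (suc d) n
lift β A = record
  { base = β ∷ base
  ; basis = Vec.map (false ∷_) basis
  ; indep = λ l p → indep l (Vec.∷-injectiveʳ (trans (sym (comb-lift l basis)) p))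
  }
  where open Affine A

-- Meets the half x₁ = 0 in A and the half x₁ = 1 in A + c; c = 0 gives the cylinder over A.
cone : ∀ {n} → Ω d → Affine d n → Affine (suc d) (suc n)
cone c A = record
  { base = false ∷ base
  ; basis = (true ∷ c) ∷ Vec.map (false ∷_) basis
  ; indep = λ
    { (false ∷ l) p → cong (false ∷_) (indep l (Vec.∷-injectiveʳ (trans (sym (comb-lift l basis)) p)))
    ; (true ∷ l) p → contradiction
        (Vec.∷-injectiveˡ (trans (sym (cong ((true ∷ c) ⊕_) (comb-lift l basis))) p)) λ () }
  }
  where open Affine A

char-lift : ∀ {n} γ β p (bs : Vec (Ω d) n) x →
  char (β ∷ p) (Vec.map (false ∷_) bs) (γ ∷ x) ≡ not (γ xor β) ∧ char p bs x
char-lift false false p [] x = refl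
char-lift false true p [] x = refl
char-lift true false p [] x = refl
char-lift true true p [] x = refl
char-lift γ β p (b ∷ bs) x = trans
  (cong₂ _xor_ (char-lift γ β p bs x)
    (trans (cong (λ g → char (β ∷ p) (Vec.map (false ∷_) bs) (g ∷ (x ⊕ b))) (Bool.xor-identityʳ γ)) (char-lift γ β p bs (x ⊕ b))))
  (sym (Bool.∧-distribˡ-xor (not (γ xor β)) (char p bs x) (char p bs (x ⊕ b))))

charA-lift : ∀ {n} γ β (A : Affine d n) x → charA (lift β A) (γ ∷ x) ≡ not (γ xor β) ∧ charA A x
charA-lift γ β A x = trans (charA-char (lift β A) (γ ∷ x)) (trans (char-lift γ β base basis x)
    (cong (not (γ xor β) ∧_) (sym (charA-char A x))))
  where open Affine A

charA-cone-false : ∀ {n} c (A : Affine d n) x → charA (cone c A) (false ∷ x) ≡ charA A x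
charA-cone-false c A x = trans (charA-char (cone c A) (false ∷ x)) (trans
    (cong₂ _xor_ (char-lift false false base basis x) (char-lift true false base basis (x ⊕ c)))
    (trans (Bool.xor-identityʳ _) (sym (charA-char A x))))
  where open Affine A

charA-cone-true : ∀ {n} c (A : Affine d n) x → charA (cone c A) (true ∷ x) ≡ charA A (x ⊕ c)
charA-cone-true c A x = trans (charA-char (cone c A) (true ∷ x)) (trans
    (cong₂ _xor_ (char-lift true false base basis x) (char-lift false false base basis (x ⊕ c)))
    (sym (charA-char A (x ⊕ c))))
  where open Affine A

Deg-char : ∀ {n} p (bs : Vec (Ω d) n) → Deg< (suc d ∸ n) d (char p bs)
Deg-char p [] = Deg-total
Deg-char {d} {suc n} p (b ∷ bs) = subst (λ r → Deg< r d (char p (b ∷ bs))) (ℕ.pred[m∸n]≡m∸[1+n] (suc d) n)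
  (Deg-∂ b (Deg-char p bs))

charSum : List (CodimAff d r) → Subset d
charSum As x = foldr _xor_ false (map (λ B → charA (CodimAff.aff B) x) As)

RM⇒Deg : ∀ r → RM r d S → Deg< (suc r) d S
RM⇒Deg {d} r (As , e) = Deg-ext (λ x → sym (e x)) (go As)
  where
  go : ∀ As → Deg< (suc r) d (charSum As)
  go [] = Deg-false
  go (B ∷ As) = Deg-xor (Deg-ext (λ x → sym (charA-char aff x))
      (Deg-mono (ℕ.m≤n+o⇒m∸n≤o (suc d) dim le) (Deg-char (Affine.base aff) (Affine.basis aff)))) (go As)
    where
    open CodimAff B
    le : suc d ℕ.≤ dim ℕ.+ suc r
    le = ℕ.≤-trans (s≤s codim≤) (ℕ.≤-reflexive (sym (ℕ.+-suc dim r)))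

RM-ext : S ≗ T → RM r d S → RM r d T
RM-ext e (As , p) = As , λ x → trans (sym (e x)) (p x)

RM-xor : RM r d S → RM r d T → RM r d (S ⊻ T)
RM-xor (As , p) (Bs , q) = As ++ Bs , λ x → trans (cong₂ _xor_ (p x) (q x)) (go x As)
  where
  go : ∀ x As → charSum As x xor charSum Bs x ≡ charSum (As ++ Bs) x
  go x [] = refl
  go x (A ∷ As) = trans (Bool.xor-assoc (charA (CodimAff.aff A) x) _ _) (cong (charA (CodimAff.aff A) x xor_) (go x As))

RM-cylinder : RM r d S → RM r (suc d) (S ∘ Vec.tail)
RM-cylinder {r} {d} (As , p) = map cyl As , λ { (γ ∷ x) → trans (p x) (go γ x As) }
  where
  cyl : CodimAff d r → CodimAff (suc d) r
  cyl B = record { dim = suc dim ; aff = cone zeroΩ aff ; codim≤ = s≤s codim≤ }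
    where open CodimAff B
  val : ∀ γ x B → charA (CodimAff.aff B) x ≡ charA (CodimAff.aff (cyl B)) (γ ∷ x)
  val false x B = sym (charA-cone-false zeroΩ (CodimAff.aff B) x)
  val true x B = sym (trans (charA-cone-true zeroΩ (CodimAff.aff B) x) (cong (charA (CodimAff.aff B)) (⊕-identityʳ x)))
  go : ∀ γ x As → charSum As x ≡ charSum (map cyl As) (γ ∷ x)
  go γ x [] = refl
  go γ x (B ∷ As) = cong₂ _xor_ (val γ x B) (go γ x As)

RM-half : RM r d S → RM (suc r) (suc d) (λ x → Vec.head x ∧ S (Vec.tail x))
RM-half {r} {d} {S} (As , p) = map half As , λ { (γ ∷ x) → trans (cong (γ ∧_) (p x)) (go γ x As) }
  where
  half : CodimAff d r → CodimAff (suc d) (suc r)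
  half B = record { dim = dim ; aff = lift true aff
                  ; codim≤ = ℕ.≤-trans (s≤s codim≤) (ℕ.≤-reflexive (sym (ℕ.+-suc dim r))) }
    where open CodimAff B
  val : ∀ γ x B → γ ∧ charA (CodimAff.aff B) x ≡ charA (CodimAff.aff (half B)) (γ ∷ x)
  val false x B = sym (charA-lift false true (CodimAff.aff B) x)
  val true x B = sym (charA-lift true true (CodimAff.aff B) x)
  go : ∀ γ x As → γ ∧ charSum As x ≡ charSum (map half As) (γ ∷ x)
  go γ x [] = Bool.∧-zeroʳ γ
  go γ x (B ∷ As) = trans (Bool.∧-distribˡ-xor γ (charA (CodimAff.aff B) x) _) (cong₂ _xor_ (val γ x B) (go γ x As))

origin : Affine 0 0
origin = record { base = [] ; basis = [] ; indep = λ { [] _ → refl } }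

-- Follows S = S₀ + x₁ (S₀ + S₁): cylinders over flats keep their codimension, while flats placed in
-- the hyperplane x₁ = 1 gain one, matching the lower degree of S₀ + S₁.
Deg⇒RM : Deg< (suc r) d S → RM r d S
Deg⇒RM {S = S} const with S [] in e
... | false = [] , λ { [] → e }
... | true = record { dim = 0 ; aff = origin ; codim≤ = z≤n } ∷ [] , λ { [] → e }
Deg⇒RM {zero} {S = S} (split s (null p)) = RM-ext (by-halves (λ _ → refl) (λ x → xor-false (lo S x) (hi S x) (p x)))
    (RM-cylinder (Deg⇒RM s))
Deg⇒RM {suc r} {S = S} (split s t) = RM-ext
    (by-halves (λ x → Bool.xor-identityʳ (lo S x)) (λ x → xor-cancelˡ (lo S x) (hi S x)))
    (RM-xor (RM-cylinder (Deg⇒RM s)) (RM-half (Deg⇒RM t)))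

-- Classification of minimal vectors

-- The minimal vectors of index k: ± 2 ^ j on the points of a flat of dimension k − 2 j.
record Form (k : ℕ) {d : ℕ} (X : Fn d) : Set where
  constructor form
  field
    j : ℕ
    {n} : ℕ
    flats : Affine d n
    sign : Subset d
    size : 2 ℕ.* j ℕ.+ n ≡ k
    quadratic : Deg< 3 d sign
    value : ∀ x → X x ≡ signed (sign x) (+ (2 ℕ.^ j) ℤ.* indicator (charA flats x))

Form⇒Λ : Form k X → Λ k d X
Form⇒Λ {d = d} (form j A S refl q v) = Λ-ext (λ x → sym (v x)) (Λ-twist q
    (Λ-ext (λ x → cong (λ b → + (2 ℕ.^ j) ℤ.* indicator b) (sym (charA-char A x)))
      (Λ-2^ j (Λ-flat base basis indep))))
  where open Affine A

Form-N : {X : Fn d} → Form k X → N X ≡ + (2 ℕ.^ k)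
Form-N {X = X} (form j {n} A S refl q v) = begin
    N X                                                         ≡⟨ N-cong v ⟩
    N (twist S (λ x → m ℤ.* indicator (charA A x)))             ≡⟨ N-signed S _ ⟩
    N (λ x → m ℤ.* indicator (charA A x))                       ≡⟨ sumΩ-cong (λ x → idem (charA A x)) ⟩
    sumΩ (λ x → (m ℤ.* m) ℤ.* indicator (charA A x))            ≡⟨ sumΩ-scale (m ℤ.* m) (λ x → indicator (charA A x)) ⟩
    (m ℤ.* m) ℤ.* sumΩ (λ x → indicator (charA A x))            ≡⟨ cong (λ z → (m ℤ.* m) ℤ.* z)
      (trans (sumΩ-cong λ x → cong indicator (charA-char A x)) (sumΩ-flat base basis indep)) ⟩
    (m ℤ.* m) ℤ.* + (2 ℕ.^ n)
      ≡⟨ cong (ℤ._* + (2 ℕ.^ n)) (sym (ℤ.pos-* (2 ℕ.^ j) (2 ℕ.^ j))) ⟩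
    + (2 ℕ.^ j ℕ.* 2 ℕ.^ j) ℤ.* + (2 ℕ.^ n)                     ≡⟨ sym (ℤ.pos-* (2 ℕ.^ j ℕ.* 2 ℕ.^ j) (2 ℕ.^ n)) ⟩
    + (2 ℕ.^ j ℕ.* 2 ℕ.^ j ℕ.* 2 ℕ.^ n)
      ≡⟨ cong (λ z → + (z ℕ.* 2 ℕ.^ n)) (sym (ℕ.^-distribˡ-+-* 2 j j)) ⟩
    + (2 ℕ.^ (j ℕ.+ j) ℕ.* 2 ℕ.^ n)                             ≡⟨ cong +_ (sym (ℕ.^-distribˡ-+-* 2 (j ℕ.+ j) n)) ⟩
    + (2 ℕ.^ (j ℕ.+ j ℕ.+ n))
      ≡⟨ cong (λ z → + (2 ℕ.^ (j ℕ.+ z ℕ.+ n))) (sym (ℕ.+-identityʳ j)) ⟩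
    + (2 ℕ.^ (2 ℕ.* j ℕ.+ n))                                   ∎
  where
  open ≡-Reasoning
  open Affine A
  m = + (2 ℕ.^ j)
  one : ∀ m → (m ℤ.* 1ℤ) ℤ.* (m ℤ.* 1ℤ) ≡ (m ℤ.* m) ℤ.* 1ℤ
  one = solve-∀
  zer : ∀ m → (m ℤ.* 0ℤ) ℤ.* (m ℤ.* 0ℤ) ≡ (m ℤ.* m) ℤ.* 0ℤ
  zer = solve-∀
  idem : ∀ b → (m ℤ.* indicator b) ℤ.* (m ℤ.* indicator b) ≡ (m ℤ.* m) ℤ.* indicator b
  idem false = zer m
  idem true = one m

signed-0 : ∀ s → signed s 0ℤ ≡ 0ℤ
signed-0 false = refl
signed-0 true = refl

Form-half : ∀ {k d X} β {Y : Fn d} → Form k Y → (∀ x → X (β ∷ x) ≡ Y x) → (∀ x → X (not β ∷ x) ≡ 0ℤ) → Form k X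
Form-half {X = X} β {Y} (form j A S s q v) e z = form j (lift β A) (S ∘ Vec.tail) s
    (split q (Deg-ext (λ x → sym (Bool.xor-same (S x))) Deg-false)) (go β e z)
  where
  value : Bool → Ω _ → ℤ
  value b x = signed (S x) (+ (2 ℕ.^ j) ℤ.* indicator b)
  on : ∀ β → (∀ x → X (β ∷ x) ≡ Y x) → ∀ x → X (β ∷ x) ≡ value (charA (lift β A) (β ∷ x)) x
  on β e x = trans (e x) (trans (v x) (cong (λ b → value b x)
    (sym (trans (charA-lift β β A x) (cong (λ b → not b ∧ charA A x) (Bool.xor-same β))))))
  off : ∀ β → (∀ x → X (not β ∷ x) ≡ 0ℤ) → ∀ x → X (not β ∷ x) ≡ value (charA (lift β A) (not β ∷ x)) x
  off β z x = trans (z x) (sym (trans (cong (λ b → value b x) (trans (charA-lift (not β) β A x)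
    (cong (λ b → not b ∧ charA A x) (lem β)))) (trans (cong (signed (S x)) (ℤ.*-zeroʳ (+ (2 ℕ.^ j)))) (signed-0 (S x)))))
    where
    lem : ∀ β → not β xor β ≡ true
    lem false = refl
    lem true = refl
  go : ∀ β → (∀ x → X (β ∷ x) ≡ Y x) → (∀ x → X (not β ∷ x) ≡ 0ℤ) → ∀ x →
    X x ≡ value (charA (lift β A) x) (Vec.tail x)
  go false e z = by-halves (on false e) (off false z)
  go true e z = by-halves (off true z) (on true e)

-- The glued sign S′ has S′₀ + S′₁ = ∂_c S + U. Both summands are affine, since S is quadratic, so
-- S′ is again quadratic.
Form-cone : ∀ {k d X} {U : Subset d} → Form k (lo X) → Deg< 2 d U → ∀ c →
  (∀ x → hi X x ≡ signed (U x) (lo X (x ⊕ c))) → Form (suc k) X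
Form-cone {X = X} {U} (form j {n} A S s q v) u c e = form j (cone c A) S′
    (trans (ℕ.+-suc (2 ℕ.* j) n) (cong suc s))
    (split q (Deg-ext (λ x → trans (Bool.xor-assoc (S x) _ _) (cong (S x xor_) (Bool.xor-comm (S (x ⊕ c)) (U x)))) (Deg-xor (Deg-∂ c q) u)))
    (by-halves
      (λ x → trans (v x) (cong (λ b → signed (S x) (+ (2 ℕ.^ j) ℤ.* indicator b)) (sym (charA-cone-false c A x))))
      (λ x → trans (e x) (trans (cong (signed (U x)) (trans (v (x ⊕ c))
          (cong (λ b → signed (S (x ⊕ c)) (+ (2 ℕ.^ j) ℤ.* indicator b)) (sym (charA-cone-true c A x)))))
        (sym (signed-xor (U x) (S (x ⊕ c)) _)))))
  where
  S′ : Subset _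
  S′ (false ∷ x) = S x
  S′ (true ∷ x) = U x xor S (x ⊕ c)

∣i∣²≡1⇒signed : ∀ i → ℤ.∣ i ∣ ℕ.* ℤ.∣ i ∣ ≡ 1 → ∃ λ s → i ≡ signed s 1ℤ
∣i∣²≡1⇒signed (+ n) p = false , cong +_ (ℕ.m*n≡1⇒m≡1 n n p)
∣i∣²≡1⇒signed ℤ.-[1+ zero ] p = true , refl

Form-origin : ∀ j s {X : Fn 0} → X [] ≡ signed s (+ (2 ℕ.^ j)) → Form (2 ℕ.* j) X
Form-origin j s {X} p = form j origin (λ _ → s) (ℕ.+-identityʳ (2 ℕ.* j)) const
  λ { [] → trans p (cong (signed s) (sym (ℤ.*-identityʳ (+ (2 ℕ.^ j))))) }

-- Here h = ⌈k/2⌉ gives 2h ≥ k, and q ≠ 0 gives 2^(2h) ≤ 2^k. Hence k = 2h is even and nothing is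
-- left for q but 1.
leaf-norm : ∀ k q → 2 ℕ.^ ⌈ k /2⌉ ℕ.* 2 ℕ.^ ⌈ k /2⌉ ℕ.* q ≡ 2 ℕ.^ k → 2 ℕ.* ⌈ k /2⌉ ≡ k × q ≡ 1
leaf-norm k q p = trans double even , ℕ.*-cancelˡ-≡ q 1 (2 ℕ.^ k) {{ℕ.m^n≢0 2 k}}
    (trans (cong (ℕ._* q) (sym square-h)) (trans p (sym (ℕ.*-identityʳ (2 ℕ.^ k)))))
  where
  h = ⌈ k /2⌉
  double : 2 ℕ.* h ≡ h ℕ.+ h
  double = cong (h ℕ.+_) (ℕ.+-identityʳ h)
  q≢0 : q ≢ 0
  q≢0 refl = ℕ.≢-nonZero⁻¹ _ {{ℕ.m^n≢0 2 k}} (trans (sym p) (ℕ.*-zeroʳ (2 ℕ.^ h ℕ.* 2 ℕ.^ h)))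
  square-h : 2 ℕ.^ h ℕ.* 2 ℕ.^ h ≡ 2 ℕ.^ k
  square-h = ℕ.≤-antisym (subst (2 ℕ.^ h ℕ.* 2 ℕ.^ h ℕ.≤_) p
    (ℕ.m≤m*n (2 ℕ.^ h ℕ.* 2 ℕ.^ h) q {{ℕ.≢-nonZero q≢0}})) (2^k≤2^⌈k/2⌉² k)
  even : h ℕ.+ h ≡ k
  even = ℕ.≤-antisym (ℕ.≮⇒≥ λ k<2h → ℕ.<-irrefl (sym (trans (ℕ.^-distribˡ-+-* 2 h h) square-h))
      (ℕ.^-monoʳ-< 2 (s≤s (s≤s z≤n)) k<2h))
    (subst (ℕ._≤ h ℕ.+ h) (ℕ.⌊n/2⌋+⌈n/2⌉≡n k) (ℕ.+-monoˡ-≤ h (ℕ.⌊n/2⌋≤⌈n/2⌉ k)))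

≤-tight : ∀ {a b p} → p ℤ.≤ a → p ℤ.≤ b → a ℤ.+ b ≡ p ℤ.+ p → a ≡ p
≤-tight {a} {b} {p} p≤a p≤b e = ℤ.≤-antisym (+-cancelˡ-≤ b (begin
    b ℤ.+ a   ≡⟨ trans (ℤ.+-comm b a) e ⟩
    p ℤ.+ p   ≤⟨ ℤ.+-monoˡ-≤ p p≤b ⟩
    b ℤ.+ p   ∎)) p≤a
  where open ℤ.≤-Reasoning

Λ-classify : Λ k d X → N X ≡ + (2 ℕ.^ k) → Form k X
Λ-classify {d = zero} {X} free p with ∣i∣²≡1⇒signed (X []) (ℤ.+-injective (trans (sym (square (X []))) p))
... | s , e = Form-origin 0 s e
Λ-classify {d = zero} {X} (leaf {k} c e) p
  with leaf-norm (suc k) (ℤ.∣ c ∣ ℕ.* ℤ.∣ c ∣)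
    (ℤ.+-injective (trans (sym (trans (cong (λ z → z ℤ.* z) e) (square-leaf (2 ℕ.^ ⌈ suc k /2⌉) c))) p))
... | even , unit with ∣i∣²≡1⇒signed c unit
...   | s , refl = subst (λ k → Form k X) even (Form-origin ⌈ suc k /2⌉ s (trans e (lem s _)))
  where
  lem : ∀ s m → m ℤ.* signed s 1ℤ ≡ signed s m
  lem false m = ℤ.*-identityʳ m
  lem true m = trans (sym (ℤ.neg-distribʳ-* m 1ℤ)) (cong ℤ.-_ (ℤ.*-identityʳ m))
Λ-classify {k} {suc d} {X} v p with zero? (lo X) | zero? (hi X)
... | inj₁ z | _ = Form-half true (Λ-classify (Λ-hi z v)
  (trans (sym (ℤ.+-identityˡ (N (hi X)))) (trans (cong (ℤ._+ N (hi X)) (sym (N-zero z))) p))) (λ _ → refl) z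
... | inj₂ _ | inj₁ z = Form-half false (Λ-classify (Λ-lo z v)
  (trans (sym (ℤ.+-identityʳ (N (lo X)))) (trans (cong (λ a → N (lo X) ℤ.+ a) (sym (N-zero z))) p))) (λ _ → refl) z
... | inj₂ y | inj₂ z = both v p
  where
  both : ∀ {k} → Λ k (suc d) X → N X ≡ + (2 ℕ.^ k) → Form k X
  both free p = contradiction
    (subst (+ 2 ℤ.≤_) p (ℤ.+-mono-≤ (Λ-min {X = lo X} free y) (Λ-min {X = hi X} free z))) λ { (ℤ.+≤+ (s≤s ())) }
  both (node {k} a b s) p = let
      a-min = Λ-min a y
      b-min = Λ-min b z
      N-lo = ≤-tight a-min b-min (trans p (2^suc k))
      N-hi = ≤-tight b-min a-min (trans (ℤ.+-comm (N (hi X)) (N (lo X))) (trans p (2^suc k)))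
      c , U , u , e = Λ-congruent a b s N-lo N-hi
    -- Only the lower half is classified by recursion; `Λ-congruent` expresses the upper half
    -- through it.
    in Form-cone (Λ-classify a N-lo) u c e

-- Generators of Λ

-- The tensor product of a vector w of ℤ² with Y. Below, w is a unit vector (`on`) or (1, ±1)
-- (`alternate`), the shapes that carry forms to forms.
spread : (Bool → ℤ) → Fn d → Fn (suc d)
spread w Y (β ∷ x) = w β ℤ.* Y x

record Closed {d : ℕ} (P : Fn d → Set) : Set where
  field
    ext : ∀ {X Y} → X ≗ Y → P X → P Y
    add : ∀ {X Y} → P X → P Y → P (X ⊞ Y)
    mul : ∀ n {X} → P X → P (λ x → n ℤ.* X x)

Closed-spread : ∀ w {P : Fn (suc d) → Set} → Closed P → Closed (P ∘ spread w)
Closed-spread w cl = record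
  { ext = λ e → ext λ { (β ∷ x) → cong (w β ℤ.*_) (e x) }
  ; add = λ {X} {Y} p q → ext (λ { (β ∷ x) → sym (ℤ.*-distribˡ-+ (w β) (X x) (Y x)) }) (add p q)
  ; mul = λ n {X} p → ext (λ { (β ∷ x) → lem n (w β) (X x) }) (mul n p)
  }
  where
  open Closed cl
  lem : ∀ n w a → n ℤ.* (w ℤ.* a) ≡ w ℤ.* (n ℤ.* a)
  lem = solve-∀

on : Bool → Bool → ℤ
on β γ = indicator (not (γ xor β))

alternate : Bool → Bool → ℤ
alternate s γ = signed (s ∧ γ) 1ℤ

Form-on : ∀ β {Y : Fn d} → Form k Y → Form k (spread (on β) Y)
Form-on false {Y} f = Form-half false f (λ x → ℤ.*-identityˡ (Y x)) (λ x → refl)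
Form-on true {Y} f = Form-half true f (λ x → ℤ.*-identityˡ (Y x)) (λ x → refl)

Form-alternate : ∀ s {Y : Fn d} → Form k Y → Form (suc k) (spread (alternate s) Y)
Form-alternate s {Y} (form j A S size q v) = Form-cone
    (form j A S size q λ x → trans (lo-value x) (v x)) (Deg-const s) zeroΩ (λ x → trans (lem s (Y x))
      (cong (signed s) (sym (trans (lo-value (x ⊕ zeroΩ)) (cong Y (⊕-identityʳ x))))))
  where
  lo-value : ∀ x → alternate s false ℤ.* Y x ≡ Y x
  lo-value x = trans (cong (λ b → signed b 1ℤ ℤ.* Y x) (Bool.∧-zeroʳ s)) (ℤ.*-identityˡ (Y x))
  lem : ∀ s a → alternate s true ℤ.* a ≡ signed s a
  lem false = ℤ.*-identityˡ
  lem true = ℤ.-1*i≡-i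

-- Membership in the span, encoded so that a property P on Ω (d + 1) can be pulled back along spread.
Spanned : ℕ → ∀ {d} → Fn d → Set₁
Spanned k {d} X = ∀ (P : Fn d → Set) → Closed P → (∀ {Y} → Form k Y → P Y) → P X

Spanned-on : ∀ β {Y : Fn d} → Spanned k Y → Spanned k (spread (on β) Y)
Spanned-on β sp P cl gen = sp (P ∘ spread (on β)) (Closed-spread (on β) cl) (gen ∘ Form-on β)

Spanned-alternate : ∀ s {Y : Fn d} → Spanned k Y → Spanned (suc k) (spread (alternate s) Y)
Spanned-alternate s sp P cl gen = sp (P ∘ spread (alternate s)) (Closed-spread (alternate s) cl) (gen ∘ Form-alternate s)

Spanned-ext : X ≗ Y → Spanned k X → Spanned k Y
Spanned-ext e sp P cl gen = Closed.ext cl e (sp P cl gen)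

Spanned-add : Spanned k X → Spanned k Y → Spanned k (X ⊞ Y)
Spanned-add sp sq P cl gen = Closed.add cl (sp P cl gen) (sq P cl gen)

Spanned-neg : {X : Fn d} → Spanned k X → Spanned k (λ x → ℤ.- X x)
Spanned-neg {X = X} sp P cl gen = Closed.ext cl (λ x → ℤ.-1*i≡-i (X x)) (Closed.mul cl -1ℤ (sp P cl gen))

Spanned-origin : ∀ j c {X : Fn 0} → X [] ≡ + (2 ℕ.^ j) ℤ.* c → Spanned (2 ℕ.* j) X
Spanned-origin j c p P cl gen = Closed.ext cl (λ { [] → trans (ℤ.*-comm c (+ (2 ℕ.^ j))) (sym p) })
  (Closed.mul cl c (gen (Form-origin j false {λ _ → + (2 ℕ.^ j)} refl)))

Spanned-halves : {X : Fn (suc d)} → Spanned k (lo X) → Spanned k (hi X) → Spanned k X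
Spanned-halves {X = X} a b = Spanned-ext (by-halves
    (λ x → trans (ℤ.+-identityʳ _) (ℤ.*-identityˡ (lo X x)))
    (λ x → trans (ℤ.+-identityˡ _) (ℤ.*-identityˡ (hi X x))))
  (Spanned-add (Spanned-on false a) (Spanned-on true b))

data Parity : ℕ → Set where
  even : ∀ j → Parity (2 ℕ.* j)
  odd : ∀ j → Parity (suc (2 ℕ.* j))

parity? : ∀ n → Parity n
parity? zero = even 0
parity? (suc n) with parity? n
... | even j = odd j
... | odd j = subst Parity (ℕ.*-suc 2 j) (even (suc j))

⌈1+2j/2⌉ : ∀ j → ⌈ suc (2 ℕ.* j) /2⌉ ≡ suc j
⌈1+2j/2⌉ j = cong suc (sym (trans (ℕ.n≡⌊n+n/2⌋ j) (cong (λ z → ⌊ j ℕ.+ z /2⌋) (sym (ℕ.+-identityʳ j)))))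

⌈2j/2⌉ : ∀ j → ⌈ 2 ℕ.* j /2⌉ ≡ j
⌈2j/2⌉ j = sym (trans (ℕ.n≡⌈n+n/2⌉ j) (cong (λ z → ⌈ j ℕ.+ z /2⌉) (sym (ℕ.+-identityʳ j))))

Λ-origin : {X : Fn 0} → Λ k 0 X → ∃ λ c → X [] ≡ + (2 ℕ.^ ⌈ k /2⌉) ℤ.* c
Λ-origin {X = X} free = X [] , sym (ℤ.*-identityˡ (X []))
Λ-origin (leaf c p) = c , p

Λ₀⇒Spanned : {X : Fn d} → Spanned 0 X
Λ₀⇒Spanned {zero} {X} = Spanned-origin 0 (X []) (sym (ℤ.*-identityˡ (X [])))
Λ₀⇒Spanned {suc d} {X} = Spanned-halves {X = X} Λ₀⇒Spanned Λ₀⇒Spanned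

-- On 0-dimensional Ω the lattices of odd index are not spanned by their forms (they have none).
Λ₁⇒Spanned : {X : Fn 1} → Λ k 0 (lo X) → Λ k 0 (hi X) → Λ (suc k) 0 (lo X ⊟ hi X) → Spanned (suc k) X
Λ₁⇒Spanned {k} {X} a b s with parity? k
-- For k = 2j + 1 the rounding gives ⌈k/2⌉ = ⌈(k+1)/2⌉ = j + 1, so both halves already belong to the
-- even index k + 1.
... | odd j = Spanned-halves (half a) (half b)
  where
  half : {Y : Fn 0} → Λ (suc (2 ℕ.* j)) 0 Y → Spanned (suc (suc (2 ℕ.* j))) Y
  half {Y} v with Λ-origin v
  ... | c , p = subst (λ k → Spanned k Y) (ℕ.*-suc 2 j)
    (Spanned-origin (suc j) c (trans p (cong (λ h → + (2 ℕ.^ h) ℤ.* c) (⌈1+2j/2⌉ j))))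
-- Now lo - hi = 2 m e with m = 2^j, so (lo, hi) = (lo - m e) (1, 1) + m e (1, -1), with both
-- coefficients divisible by m.
... | even j with Λ-origin a | Λ-origin s
...   | c , p | e , q = Spanned-ext
      (by-halves (λ { [] → left (lo X []) (m ℤ.* e) })
        (λ { [] → trans (right (lo X []) (m ℤ.* e)) (trans (cong (λ z → lo X [] ℤ.- z) (sym double)) (sub-sub (lo X []) (hi X []))) }))
      (Spanned-add
        (Spanned-alternate false {λ _ → lo X [] ℤ.- m ℤ.* e} (Spanned-origin j (c ℤ.- e) (trans (cong (ℤ._- m ℤ.* e) p′) (factor m c e))))
        (Spanned-alternate true {λ _ → m ℤ.* e} (Spanned-origin j e refl)))
  where
  m = + (2 ℕ.^ j)
  p′ : lo X [] ≡ m ℤ.* c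
  p′ = trans p (cong (λ h → + (2 ℕ.^ h) ℤ.* c) (⌈2j/2⌉ j))
  double : lo X [] ℤ.- hi X [] ≡ m ℤ.* e ℤ.+ m ℤ.* e
  double = trans q (trans (cong (λ h → + (2 ℕ.^ h) ℤ.* e) (⌈1+2j/2⌉ j))
    (trans (cong (ℤ._* e) (2^suc j)) (ℤ.*-distribʳ-+ e m m)))
  left : ∀ a z → 1ℤ ℤ.* (a ℤ.- z) ℤ.+ 1ℤ ℤ.* z ≡ a
  left = solve-∀
  right : ∀ a z → 1ℤ ℤ.* (a ℤ.- z) ℤ.+ -1ℤ ℤ.* z ≡ a ℤ.- (z ℤ.+ z)
  right = solve-∀
  sub-sub : ∀ a b → a ℤ.- (a ℤ.- b) ≡ b
  sub-sub = solve-∀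
  factor : ∀ m c e → m ℤ.* c ℤ.- m ℤ.* e ≡ m ℤ.* (c ℤ.- e)
  factor = solve-∀

-- The decomposition is (a, b) = (a, a) - (0, a - b): doubling a flat of index k - 1 along x₁ raises
-- its index to k, and a - b has index k already.
Λ⇒Spanned : {X : Fn (suc d)} → Λ k (suc d) X → Spanned k X
Λ⇒Spanned {X = X} free = Λ₀⇒Spanned {X = X}
Λ⇒Spanned {zero} (node a b s) = Λ₁⇒Spanned a b s
Λ⇒Spanned {suc d} {X = X} (node a b s) = Spanned-ext
    (by-halves (λ x → left (lo X x) (ℤ.- (lo X x ℤ.- hi X x))) (λ x → right (lo X x) (hi X x)))
    (Spanned-add (Spanned-alternate false (Λ⇒Spanned a)) (Spanned-on true (Spanned-neg (Λ⇒Spanned s))))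
  where
  left : ∀ a b → 1ℤ ℤ.* a ℤ.+ 0ℤ ℤ.* b ≡ a
  left = solve-∀
  right : ∀ a b → 1ℤ ℤ.* a ℤ.+ 1ℤ ℤ.* (ℤ.- (a ℤ.- b)) ≡ b
  right = solve-∀

-- Comparison with BW_d and BW_d (f − 1)

open +-*-Solver using (solve; _:+_; _:*_; :-_; _:-_; _:=_)

ι : ℤ → ℚ
ι n = n ℚ./ 1

toℚᵘ-ι : ∀ n → ℚ.toℚᵘ (ι n) ℚᵘ.≃ mkℚᵘ n 0
toℚᵘ-ι n = ℚ.toℚᵘ-fromℚᵘ (mkℚᵘ n 0)

ι-+ : ∀ a b → ι (a ℤ.+ b) ≡ ι a ℚ.+ ι b
ι-+ a b = ℚ.toℚᵘ-injective (begin
    ℚ.toℚᵘ (ι (a ℤ.+ b))             ≈⟨ toℚᵘ-ι (a ℤ.+ b) ⟩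
    mkℚᵘ (a ℤ.+ b) 0                 ≈⟨ *≡* (lem a b) ⟩
    mkℚᵘ a 0 ℚᵘ.+ mkℚᵘ b 0           ≈⟨ ℚᵘ.+-cong (toℚᵘ-ι a) (toℚᵘ-ι b) ⟨
    ℚ.toℚᵘ (ι a) ℚᵘ.+ ℚ.toℚᵘ (ι b)   ≈⟨ ℚ.toℚᵘ-homo-+ (ι a) (ι b) ⟨
    ℚ.toℚᵘ (ι a ℚ.+ ι b)             ∎)
  where
  open import Relation.Binary.Reasoning.Setoid ℚᵘ.≃-setoid
  lem : ∀ a b → (a ℤ.+ b) ℤ.* 1ℤ ≡ (a ℤ.* 1ℤ ℤ.+ b ℤ.* 1ℤ) ℤ.* 1ℤ
  lem = solve-∀

ι-* : ∀ a b → ι (a ℤ.* b) ≡ ι a ℚ.* ι b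
ι-* a b = ℚ.toℚᵘ-injective (begin
    ℚ.toℚᵘ (ι (a ℤ.* b))             ≈⟨ toℚᵘ-ι (a ℤ.* b) ⟩
    mkℚᵘ a 0 ℚᵘ.* mkℚᵘ b 0           ≈⟨ ℚᵘ.*-cong (toℚᵘ-ι a) (toℚᵘ-ι b) ⟨
    ℚ.toℚᵘ (ι a) ℚᵘ.* ℚ.toℚᵘ (ι b)   ≈⟨ ℚ.toℚᵘ-homo-* (ι a) (ι b) ⟨
    ℚ.toℚᵘ (ι a ℚ.* ι b)             ∎)
  where open import Relation.Binary.Reasoning.Setoid ℚᵘ.≃-setoid

ι-neg : ∀ a → ι (ℤ.- a) ≡ ℚ.- ι a
ι-neg a = begin
    ι (ℤ.- a)             ≡⟨ cong ι (sym (ℤ.-1*i≡-i a)) ⟩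
    ι (-1ℤ ℤ.* a)         ≡⟨ ι-* -1ℤ a ⟩
    (ℚ.- 1ℚ) ℚ.* ι a      ≡⟨ sym (ℚ.neg-distribˡ-* 1ℚ (ι a)) ⟩
    ℚ.- (1ℚ ℚ.* ι a)      ≡⟨ cong ℚ.-_ (ℚ.*-identityˡ (ι a)) ⟩
    ℚ.- ι a               ∎
  where open ≡-Reasoning

ι-mono-≤ : ∀ {a b} → a ℤ.≤ b → ι a ℚ.≤ ι b
ι-mono-≤ {a} {b} a≤b = ℚ.toℚᵘ-cancel-≤ (ℚᵘ.≤-respˡ-≃ (ℚᵘ.≃-sym (toℚᵘ-ι a)) (ℚᵘ.≤-respʳ-≃ (ℚᵘ.≃-sym (toℚᵘ-ι b))
  (*≤* (subst₂ ℤ._≤_ (sym (ℤ.*-identityʳ a)) (sym (ℤ.*-identityʳ b)) a≤b))))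

ι-cancel-≤ : ∀ {a b} → ι a ℚ.≤ ι b → a ℤ.≤ b
ι-cancel-≤ {a} {b} p = subst₂ ℤ._≤_ (ℤ.*-identityʳ a) (ℤ.*-identityʳ b)
  (ℚᵘ.drop-*≤* (ℚᵘ.≤-respˡ-≃ (toℚᵘ-ι a) (ℚᵘ.≤-respʳ-≃ (toℚᵘ-ι b) (ℚ.toℚᵘ-mono-≤ p))))

ι-injective : ∀ {a b} → ι a ≡ ι b → a ≡ b
ι-injective p = ℤ.≤-antisym (ι-cancel-≤ (ℚ.≤-reflexive p)) (ι-cancel-≤ (ℚ.≤-reflexive (sym p)))

emb : ℕ → Fn d → V d
emb K X i = pow2inv K ℚ.* ι (X i)

pow2inv-+ : ∀ j m → pow2inv (j + m) ℚ.* ι (+ (2 ℕ.^ j)) ≡ pow2inv m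
pow2inv-+ zero m = ℚ.*-identityʳ (pow2inv m)
pow2inv-+ (suc j) m = begin
    ½ ℚ.* p ℚ.* ι (+ (2 ℕ.^ suc j))      ≡⟨ cong (λ z → ½ ℚ.* p ℚ.* ι z) (2^suc j) ⟩
    ½ ℚ.* p ℚ.* ι (z ℤ.+ z)              ≡⟨ cong (λ z → ½ ℚ.* p ℚ.* z) (ι-+ z z) ⟩
    ½ ℚ.* p ℚ.* (ι z ℚ.+ ι z)
      ≡⟨ solve 3 (λ h p a → h :* p :* (a :+ a) := (h :+ h) :* (p :* a)) refl ½ p (ι z) ⟩
    1ℚ ℚ.* (p ℚ.* ι z)                   ≡⟨ ℚ.*-identityˡ _ ⟩
    p ℚ.* ι z                            ≡⟨ pow2inv-+ j m ⟩
    pow2inv m                            ∎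
  where
  open ≡-Reasoning
  p = pow2inv (j + m)
  z = + (2 ℕ.^ j)

emb-injective-0 : ∀ {K} {X : Fn d} → (∀ i → emb K X i ≡ 0ℚ) → ∀ i → X i ≡ 0ℤ
emb-injective-0 {K = K} {X} p i = ι-injective (begin
    ι (X i)                                       ≡⟨ sym (ℚ.*-identityˡ (ι (X i))) ⟩
    1ℚ ℚ.* ι (X i)                                ≡⟨ cong (ℚ._* ι (X i)) (sym (trans
                                                      (cong (λ k → pow2inv k ℚ.* n) (sym (ℕ.+-identityʳ K))) (pow2inv-+ K 0))) ⟩
    pow2inv K ℚ.* n ℚ.* ι (X i)
      ≡⟨ solve 3 (λ q n a → q :* n :* a := n :* (q :* a)) refl (pow2inv K) n (ι (X i)) ⟩
    n ℚ.* emb K X i                               ≡⟨ cong (n ℚ.*_) (p i) ⟩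
    n ℚ.* 0ℚ                                      ≡⟨ ℚ.*-zeroʳ n ⟩
    0ℚ                                            ∎)
  where
  open ≡-Reasoning
  n = ι (+ (2 ℕ.^ K))

emb-signed : ∀ K s a → pow2inv K ℚ.* ι (signed s a) ≡ (if s then ℚ.- (pow2inv K ℚ.* ι a) else pow2inv K ℚ.* ι a)
emb-signed K false a = refl
emb-signed K true a = trans (cong (pow2inv K ℚ.*_) (ι-neg a)) (sym (ℚ.neg-distribʳ-* (pow2inv K) (ι a)))

emb-flat : ∀ {n} j m (A : Affine d n) S i →
  scale (pow2inv m) (ε S (vA A)) i ≡ emb (j + m) (λ x → signed (S x) (+ (2 ℕ.^ j) ℤ.* indicator (charA A x))) i
emb-flat j m A S i = begin
    pow2inv m ℚ.* (if S i then ℚ.- (if b then 1ℚ else 0ℚ) else (if b then 1ℚ else 0ℚ))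
      ≡⟨ cong (pow2inv m ℚ.*_) (unit (S i) b) ⟩
    pow2inv m ℚ.* ι u                                        ≡⟨ cong (ℚ._* ι u) (sym (pow2inv-+ j m)) ⟩
    pow2inv (j + m) ℚ.* ι t ℚ.* ι u                          ≡⟨ ℚ.*-assoc (pow2inv (j + m)) (ι t) (ι u) ⟩
    pow2inv (j + m) ℚ.* (ι t ℚ.* ι u)                        ≡⟨ cong (pow2inv (j + m) ℚ.*_) (sym (ι-* t u)) ⟩
    pow2inv (j + m) ℚ.* ι (t ℤ.* u)                          ≡⟨ cong (λ z → pow2inv (j + m) ℚ.* ι z) (pull (S i)) ⟩
    pow2inv (j + m) ℚ.* ι (signed (S i) (t ℤ.* indicator b)) ∎
  where
  open ≡-Reasoning
  b = charA A i
  t = + (2 ℕ.^ j)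
  u = signed (S i) (indicator b)
  unit : ∀ s b → (if s then ℚ.- (if b then 1ℚ else 0ℚ) else (if b then 1ℚ else 0ℚ)) ≡ ι (signed s (indicator b))
  unit false false = refl
  unit false true = refl
  unit true false = refl
  unit true true = refl
  pull : ∀ s → t ℤ.* signed s (indicator b) ≡ signed s (t ℤ.* indicator b)
  pull false = refl
  pull true = sym (ℤ.neg-distribʳ-* t (indicator b))

flat⇒Form : ∀ {n m K} {A : Affine d n} {S} {x : V d} → RM 2 d S → m ≤ K → (∀ i → x i ≡ scale (pow2inv m) (ε S (vA A)) i) →
  ∃ λ X → Form (2 * (K ∸ m) + n) X × (∀ i → x i ≡ emb K X i)
flat⇒Form {d} {m = m} {K} {A} {S} rm m≤K e = X₀ , form (K ∸ m) A S refl (RM⇒Deg 2 rm) (λ _ → refl)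
  , λ i → trans (e i) (trans (emb-flat (K ∸ m) m A S i) (cong (λ k → emb k X₀ i) (ℕ.m∸n+n≡m m≤K)))
  where
  X₀ : Fn d
  X₀ x = signed (S x) (+ (2 ℕ.^ (K ∸ m)) ℤ.* indicator (charA A x))

lincomb : List (ℤ × V d) → V d
lincomb = foldr (λ p acc → scale (proj₁ p ℚ./ 1) (proj₂ p) +V acc) zeroV

-- Multiplied by 2^d, a generator becomes 2^(d-m) v_A ε_S, of index 2(d - m) + 2m = 2d whatever m
-- is.
BW⇒Λ : ∀ {x : V d} → BW d x → ∃ λ X → Λ (2 * d) d X × (∀ i → x i ≡ emb d X i)
BW⇒Λ {d} (l , gens , e) = let X , v , q = go l gens in X , v , λ i → trans (e i) (q i)
  where
  go : ∀ l → All (λ p → IsBWGen d (proj₂ p)) l → ∃ λ X → Λ (2 * d) d X ×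
    (∀ i → lincomb l i ≡ emb d X i)
  go [] [] = (λ _ → 0ℤ) , Λ-zero , λ i → sym (ℚ.*-zeroʳ (pow2inv d))
  go ((n , x) ∷ l) ((m , A , S , rm , p) ∷ gens)
    with go l gens | flat⇒Form {m = m} {K = d} {A = A} rm (ℕ.≤-trans (ℕ.m≤n*m m 2) (dim≤ A)) p
  ... | Y , w , q | X , f , q′ = (λ x → n ℤ.* X x) ⊞ Y , Λ-add (Λ-scale n (subst (λ k → Λ k d X) size (Form⇒Λ f))) w
      , λ i → begin
        ι n ℚ.* x i ℚ.+ _                                        ≡⟨ cong₂ (λ a b → ι n ℚ.* a ℚ.+ b) (q′ i) (q i) ⟩
        ι n ℚ.* (p₂ ℚ.* ι (X i)) ℚ.+ p₂ ℚ.* ι (Y i)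
          ≡⟨ solve 4 (λ n p a b → n :* (p :* a) :+ p :* b := p :* (n :* a :+ b)) refl
                                                                       (ι n) p₂ (ι (X i)) (ι (Y i)) ⟩
        p₂ ℚ.* (ι n ℚ.* ι (X i) ℚ.+ ι (Y i))
          ≡⟨ cong (λ z → p₂ ℚ.* (z ℚ.+ ι (Y i))) (sym (ι-* n (X i))) ⟩
        p₂ ℚ.* (ι (n ℤ.* X i) ℚ.+ ι (Y i))                       ≡⟨ cong (p₂ ℚ.*_) (sym (ι-+ (n ℤ.* X i) (Y i))) ⟩
        p₂ ℚ.* ι (n ℤ.* X i ℤ.+ Y i)                             ∎
    where
    open ≡-Reasoning
    p₂ = pow2inv d
    size : 2 * (d ∸ m) + 2 * m ≡ 2 * d
    size = trans (sym (ℕ.*-distribˡ-+ 2 (d ∸ m) m)) (cong (2 *_) (ℕ.m∸n+n≡m (ℕ.≤-trans (ℕ.m≤n*m m 2) (dim≤ A))))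

BW-ext : ∀ {x y : V d} → x ≗ y → BW d x → BW d y
BW-ext p (l , gens , e) = l , gens , λ i → trans (sym (p i)) (e i)

BW-add : ∀ {x y : V d} → BW d x → BW d y → BW d (x +V y)
BW-add (l , gens , e) (l′ , gens′ , e′) = l ++ l′ , All.++⁺ gens gens′
    , λ i → trans (cong₂ ℚ._+_ (e i) (e′ i)) (go i l)
  where
  go : ∀ i l → lincomb l i ℚ.+ lincomb l′ i ≡ lincomb (l ++ l′) i
  go i [] = ℚ.+-identityˡ _
  go i ((n , v) ∷ l) = trans (ℚ.+-assoc (ι n ℚ.* v i) _ _) (cong (λ z → ι n ℚ.* v i ℚ.+ z) (go i l))

BW-scale : ∀ n {x : V d} → BW d x → BW d (scale (ι n) x)
BW-scale n (l , gens , e) = map f l , All.map⁺ gens , λ i → trans (cong (λ z → ι n ℚ.* z) (e i)) (go i l)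
  where
  f : ℤ × V _ → ℤ × V _
  f (m , v) = n ℤ.* m , v
  go : ∀ i l → ι n ℚ.* lincomb l i ≡ lincomb (map f l) i
  go i [] = ℚ.*-zeroʳ (ι n)
  go i ((m , v) ∷ l) = trans (ℚ.*-distribˡ-+ (ι n) (ι m ℚ.* v i) _) (cong₂ ℚ._+_
    (trans (sym (ℚ.*-assoc (ι n) (ι m) (v i))) (cong (ℚ._* v i) (sym (ι-* n m)))) (go i l))

BW-closed : ∀ K → Closed {d} (λ X → BW d (emb K X))
BW-closed K = record
  { ext = λ e → BW-ext λ i → cong (λ z → pow2inv K ℚ.* ι z) (e i)
  ; add = λ {X} {Y} a b → BW-ext (λ i → trans (sym (ℚ.*-distribˡ-+ (pow2inv K) (ι (X i)) (ι (Y i))))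
      (cong (pow2inv K ℚ.*_) (sym (ι-+ (X i) (Y i))))) (BW-add a b)
  ; mul = λ n {X} a → BW-ext (λ i → trans
      (solve 3 (λ n p x → n :* (p :* x) := p :* (n :* x)) refl (ι n) (pow2inv K) (ι (X i)))
      (cong (pow2inv K ℚ.*_) (sym (ι-* n (X i))))) (BW-scale n a)
  }

-- e is the parity of the dimension: 0 for generators of BW_d, 1 for minimal vectors of its image
-- under f - 1. From j > K would follow 2j ≥ 2K + 2 > 2K + e.
halve : ∀ e {j n K} → e ≤ 1 → 2 * j + n ≡ e + 2 * K → j + (K ∸ j) ≡ K × n ≡ 2 * (K ∸ j) + e
halve e {j} {n} {K} e≤1 p = ℕ.m+[n∸m]≡n j≤K , (begin
    n                       ≡⟨ sym (ℕ.m+n∸m≡n (2 * j) n) ⟩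
    2 * j + n ∸ 2 * j       ≡⟨ cong (_∸ 2 * j) (trans p (ℕ.+-comm e (2 * K))) ⟩
    2 * K + e ∸ 2 * j       ≡⟨ ℕ.+-∸-comm e (ℕ.*-monoʳ-≤ 2 j≤K) ⟩
    2 * K ∸ 2 * j + e       ≡⟨ cong (_+ e) (sym (ℕ.*-distribˡ-∸ 2 K j)) ⟩
    2 * (K ∸ j) + e         ∎)
  where
  open ≡-Reasoning
  j≤K : j ≤ K
  j≤K = ℕ.≮⇒≥ λ K<j → ℕ.<-irrefl refl (ℕ.≤-trans (ℕ.≤-reflexive (sym (ℕ.*-suc 2 K)))
    (ℕ.≤-trans (ℕ.*-monoʳ-≤ 2 K<j) (ℕ.≤-trans (ℕ.m≤m+n (2 * j) n) (ℕ.≤-trans (ℕ.≤-reflexive p) (ℕ.+-monoˡ-≤ (2 * K) e≤1)))))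

Form⇒flat : ∀ {e K} {X : Fn d} → e ≤ 1 → Form (e + 2 * K) X → ∃ λ m → Σ (Affine d (2 * m + e)) λ A → ∃ λ S →
  RM 2 d S × (∀ i → emb K X i ≡ scale (pow2inv m) (ε S (vA A)) i)
Form⇒flat {e = e} {K} {X} e≤1 (form j {n} A S size q v) with halve e {j} {n} {K} e≤1 size
... | j+m≡K , refl = K ∸ j , A , S , Deg⇒RM q , λ i → trans (cong (λ z → pow2inv K ℚ.* ι z) (v i))
  (trans (cong (λ k → emb k (λ x → signed (S x) (+ (2 ℕ.^ j) ℤ.* indicator (charA A x))) i) (sym j+m≡K))
    (sym (emb-flat j (K ∸ j) A S i)))

-- K is kept apart from the dimension because inverting f - 1 introduces one more factor ½ and calls
-- for an exponent one larger than the dimension.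
Λ⇒BW : ∀ K {X : Fn (suc d)} → Λ (2 * K) (suc d) X → BW (suc d) (emb K X)
Λ⇒BW {d} K v = Λ⇒Spanned v (λ X → BW (suc d) (emb K X)) (BW-closed K) generator
  where
  generator : ∀ {X} → Form (2 * K) X → BW (suc d) (emb K X)
  generator {X} f with Form⇒flat {e = 0} {K} z≤n f
  ... | m , A , S , rm , p = (1ℤ , emb K X) ∷ []
      , (m , subst (Affine (suc d)) 2m A , S , rm , λ i → trans (p i) (same 2m i)) ∷ []
      , λ i → sym (trans (ℚ.+-identityʳ _) (ℚ.*-identityˡ (emb K X i)))
    where
    2m = ℕ.+-identityʳ (2 * m)
    same : ∀ {n} (e : 2 * m + 0 ≡ n) i → scale (pow2inv m) (ε S (vA A)) i ≡ scale (pow2inv m) (ε S (vA (subst (Affine (suc d)) e A))) i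
    same refl i = refl

-- The action of R_d and the image of the lattice under f - 1.

actℤ : Word d → Fn d → Fn d
actℤ [] X = X
actℤ (ε∷ S _ w) X = actℤ w (twist S X)
actℤ (τ∷ c w) X = actℤ w (shift c X)

-- Telescoping along the word: each generator moves a vector by an element of the next lattice, so
-- the image stays in `Λ k` and the remaining word can be applied to it.
Λ-act-fix : ∀ (f : Word d) → Λ k d X → Λ (suc k) d (actℤ f X ⊟ X)
Λ-act-fix {X = X} [] a = Λ-ext (λ x → sym (ℤ.+-inverseʳ (X x))) Λ-zero
Λ-act-fix {X = X} (ε∷ S rm w) a = Λ-ext (λ x → chain (actℤ w (twist S X) x) (twist S X x) (X x))
    (Λ-add (Λ-act-fix w (Λ-ext (λ x → recover (twist S X x) (X x)) (Λ-add (Λ-down b) a))) b)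
  where
  b = Λ-twist-fix₁ (RM⇒Deg 1 rm) a
Λ-act-fix {X = X} (τ∷ c w) a = Λ-ext (λ x → chain (actℤ w (shift c X) x) (shift c X x) (X x))
    (Λ-add (Λ-act-fix w (Λ-ext (λ x → recover (shift c X x) (X x)) (Λ-add (Λ-down b) a))) b)
  where
  b = Λ-shift-fix c a

ε-cong : ∀ (S : Subset d) {x y : V d} → x ≗ y → ε S x ≗ ε S y
ε-cong S p i with S i
... | false = p i
... | true = cong ℚ.-_ (p i)

act-cong : ∀ (f : Word d) {x y : V d} → x ≗ y → act f x ≗ act f y
act-cong [] p = p
act-cong (ε∷ S _ w) p = act-cong w (ε-cong S p)
act-cong (τ∷ c w) p = act-cong w (λ i → p (i ⊕ c))

act-emb : ∀ (f : Word d) K X → act f (emb K X) ≗ emb K (actℤ f X)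
act-emb [] K X i = refl
act-emb (ε∷ S _ w) K X i = trans (act-cong w (λ i → sym (emb-signed K (S i) (X i))) i) (act-emb w K (twist S X) i)
act-emb (τ∷ c w) K X i = act-emb w K (shift c X) i

act-add : ∀ (f : Word d) x y → act f (x +V y) ≗ act f x +V act f y
act-add [] x y i = refl
act-add (ε∷ S _ w) x y i = trans (act-cong w (λ i → lem (S i) (x i) (y i)) i) (act-add w (ε S x) (ε S y) i)
  where
  lem : ∀ s a b → (if s then ℚ.- (a ℚ.+ b) else (a ℚ.+ b)) ≡ (if s then ℚ.- a else a) ℚ.+ (if s then ℚ.- b else b)
  lem false a b = refl
  lem true a b = ℚ.neg-distrib-+ a b
act-add (τ∷ c w) x y i = act-add w (τ c x) (τ c y) i

act-scale : ∀ (f : Word d) q x → act f (scale q x) ≗ scale q (act f x)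
act-scale [] q x i = refl
act-scale (ε∷ S _ w) q x i = trans (act-cong w (λ i → lem (S i) (x i)) i) (act-scale w q (ε S x) i)
  where
  lem : ∀ s a → (if s then ℚ.- (q ℚ.* a) else (q ℚ.* a)) ≡ q ℚ.* (if s then ℚ.- a else a)
  lem false a = refl
  lem true a = ℚ.neg-distribʳ-* q a
act-scale (τ∷ c w) q x i = act-scale w q (τ c x) i

Lminus⇒Λ : ∀ (f : Word d) {y} → Lminus (BW d) f y → ∃ λ Y → Λ (suc (2 * d)) d Y × (∀ i → y i ≡ emb d Y i)
Lminus⇒Λ {d} f (x , bw , e) with BW⇒Λ bw
... | X , v , p = actℤ f X ⊟ X , Λ-act-fix f v , λ i → begin
    _                                            ≡⟨ e i ⟩
    act f x i ℚ.- x i                            ≡⟨ cong₂ ℚ._-_ (trans (act-cong f p i) (act-emb f d X i)) (p i) ⟩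
    emb d (actℤ f X) i ℚ.- emb d X i             ≡⟨ solve 3 (λ p a b → p :* a :- p :* b := p :* (a :+ :- b)) refl
                                                      (pow2inv d) (ι (actℤ f X i)) (ι (X i)) ⟩
    pow2inv d ℚ.* (ι (actℤ f X i) ℚ.+ ℚ.- ι (X i))
      ≡⟨ cong (λ z → pow2inv d ℚ.* (ι (actℤ f X i) ℚ.+ z)) (sym (ι-neg (X i))) ⟩
    pow2inv d ℚ.* (ι (actℤ f X i) ℚ.+ ι (ℤ.- X i))   ≡⟨ cong (pow2inv d ℚ.*_) (sym (ι-+ (actℤ f X i) (ℤ.- X i))) ⟩
    emb d (actℤ f X ⊟ X) i                       ∎
  where open ≡-Reasoning

-- f² = −1 makes f − 1 invertible, with inverse −(f + 1)/2.
Λ⇒Lminus : ∀ (f : Word (suc d)) → Fourvolution f → ∀ {y Y} → Λ (suc (2 * suc d)) (suc d) Y → (∀ i → y i ≡ emb (suc d) Y i) →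
  Lminus (BW (suc d)) f y
Λ⇒Lminus {d} f four {y} {Y} v e = x , BW-ext x-emb (Λ⇒BW (suc (suc d)) (subst (λ k → Λ k (suc d) Z) (sym (ℕ.*-suc 2 (suc d))) w)) , solves
  where
  open ≡-Reasoning
  q = ℚ.- ½
  x : V (suc d)
  x = scale q (act f y +V y)
  Z : Fn (suc d)
  Z i = ℤ.- (actℤ f Y i ℤ.+ Y i)
  -- From f + 1 = (f - 1) + 2, both summands lift Y to index at least 2(D + 1), where D is the
  -- dimension; this is the index that denominator 2^(D+1) requires, so the ½ in x is absorbed.
  w : Λ (2 + 2 * suc d) (suc d) Z
  w = Λ-neg (Λ-ext (λ i → lem (actℤ f Y i) (Y i)) (Λ-add (Λ-act-fix f v) (Λ-down (Λ-double {X = Y} v))))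
    where
    lem : ∀ a b → (a ℤ.- b) ℤ.+ (b ℤ.+ b) ≡ a ℤ.+ b
    lem = solve-∀
  x-emb : emb (suc (suc d)) Z ≗ x
  x-emb i = begin
    ½ ℚ.* p ℚ.* ι (Z i)
      ≡⟨ cong (λ z → ½ ℚ.* p ℚ.* z) (trans (ι-neg (actℤ f Y i ℤ.+ Y i)) (cong ℚ.-_ (ι-+ (actℤ f Y i) (Y i)))) ⟩
    ½ ℚ.* p ℚ.* (ℚ.- (ι (actℤ f Y i) ℚ.+ ι (Y i)))
      ≡⟨ solve 4 (λ h p a b → h :* p :* (:- (a :+ b)) := :- h :* (p :* a :+ p :* b)) refl
                                                              ½ p (ι (actℤ f Y i)) (ι (Y i)) ⟩
    q ℚ.* (emb (suc d) (actℤ f Y) i ℚ.+ emb (suc d) Y i)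
      ≡⟨ cong (q ℚ.*_) (cong₂ ℚ._+_ (sym (trans (act-cong f e i) (act-emb f (suc d) Y i))) (sym (e i))) ⟩
    x i                                                  ∎
    where p = pow2inv (suc d)
  solves : ∀ i → y i ≡ act f x i ℚ.- x i
  solves i = sym (begin
    act f x i ℚ.- x i
      ≡⟨ cong (ℚ._- x i) (trans (act-scale f q (act f y +V y) i)
                                                                          (cong (q ℚ.*_) (trans (act-add f (act f y) y i) (cong (ℚ._+ act f y i) (four y i))))) ⟩
    q ℚ.* (ℚ.- y i ℚ.+ act f y i) ℚ.- q ℚ.* (act f y i ℚ.+ y i)
      ≡⟨ solve 3 (λ q y a → q :* (:- y :+ a) :- q :* (a :+ y) := :- (q :+ q) :* y) refl q (y i) (act f y i) ⟩
    1ℚ ℚ.* y i                                                       ≡⟨ ℚ.*-identityˡ (y i) ⟩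
    y i                                                              ∎)

-- Comparison of norms and the two inclusions.

open Total ℚ.+-0-isCommutativeMonoid using () renaming (total to sumℚ; total-suc to sumℚ-suc)

sumℚ-square : ∀ {d} p {x : V d} {X} → (∀ i → x i ≡ p ℚ.* ι (X i)) → sumℚ (λ i → x i ℚ.* x i) ≡ p ℚ.* p ℚ.* ι (N X)
sumℚ-square {zero} p {x} {X} e = begin
    x [] ℚ.* x [] ℚ.+ 0ℚ                       ≡⟨ ℚ.+-identityʳ _ ⟩
    x [] ℚ.* x []                              ≡⟨ cong₂ ℚ._*_ (e []) (e []) ⟩
    p ℚ.* ι (X []) ℚ.* (p ℚ.* ι (X []))
      ≡⟨ solve 2 (λ p a → p :* a :* (p :* a) := p :* p :* (a :* a)) refl p (ι (X [])) ⟩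
    p ℚ.* p ℚ.* (ι (X []) ℚ.* ι (X []))        ≡⟨ cong (p ℚ.* p ℚ.*_) (sym (ι-* (X []) (X []))) ⟩
    p ℚ.* p ℚ.* ι (N X)                        ∎
  where open ≡-Reasoning
sumℚ-square {suc d} p {x} {X} e = begin
    sumℚ (λ i → x i ℚ.* x i)                                   ≡⟨ sumℚ-suc (λ i → x i ℚ.* x i) ⟩
    _
      ≡⟨ cong₂ ℚ._+_ (sumℚ-square p {lo x} {lo X} (e ∘ (false ∷_))) (sumℚ-square p {hi x} {hi X} (e ∘ (true ∷_))) ⟩
    p ℚ.* p ℚ.* ι (N (lo X)) ℚ.+ p ℚ.* p ℚ.* ι (N (hi X))      ≡⟨ sym (ℚ.*-distribˡ-+ (p ℚ.* p) _ _) ⟩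
    p ℚ.* p ℚ.* (ι (N (lo X)) ℚ.+ ι (N (hi X)))                ≡⟨ cong (p ℚ.* p ℚ.*_) (sym (ι-+ (N (lo X)) (N (hi X)))) ⟩
    p ℚ.* p ℚ.* ι (N X)                                        ∎
  where open ≡-Reasoning

normFactor : ℕ → ℚ
normFactor d = ι (+ (2 ℕ.^ (d / 2))) ℚ.* (pow2inv d ℚ.* pow2inv d)

pow2inv-positive : ∀ m → ℚ.Positive (pow2inv m)
pow2inv-positive zero = _
pow2inv-positive (suc m) = ℚ.pos*pos⇒pos ½ (pow2inv m) {{pow2inv-positive m}}

normFactor-positive : ∀ d → ℚ.Positive (normFactor d)
normFactor-positive d = ℚ.pos*pos⇒pos (ι (+ (2 ℕ.^ (d / 2)))) {{ℚ.normalize-pos (2 ℕ.^ (d / 2)) 1 {{_}} {{ℕ.m^n≢0 2 (d / 2)}}}}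
  (pow2inv d ℚ.* pow2inv d) {{ℚ.pos*pos⇒pos (pow2inv d) {{pow2inv-positive d}} (pow2inv d) {{pow2inv-positive d}}}}

normV-emb : ∀ {y : V d} {Y} → (∀ i → y i ≡ emb d Y i) → normV y ≡ normFactor d ℚ.* ι (N Y)
normV-emb {d} {Y = Y} e = trans (cong (ι (+ (2 ℕ.^ (d / 2))) ℚ.*_) (sumℚ-square (pow2inv d) {X = Y} e))
  (sym (ℚ.*-assoc (ι (+ (2 ℕ.^ (d / 2)))) (pow2inv d ℚ.* pow2inv d) (ι (N Y))))

normV-cancel : ∀ {y z : V d} {Y Z} → (∀ i → y i ≡ emb d Y i) → (∀ i → z i ≡ emb d Z i) → normV y ℚ.≤ normV z → N Y ℤ.≤ N Z
normV-cancel {d} {Y = Y} {Z} p q le = ι-cancel-≤ (ℚ.*-cancelˡ-≤-pos (normFactor d) {{normFactor-positive d}}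
  (subst₂ ℚ._≤_ (normV-emb {Y = Y} p) (normV-emb {Y = Z} q) le))

normV-mono : ∀ {y z : V d} {Y Z} → (∀ i → y i ≡ emb d Y i) → (∀ i → z i ≡ emb d Z i) → N Y ℤ.≤ N Z → normV y ℚ.≤ normV z
normV-mono {d} {Y = Y} {Z} p q le = subst₂ ℚ._≤_ (sym (normV-emb {Y = Y} p)) (sym (normV-emb {Y = Z} q))
  (ℚ.*-monoˡ-≤-nonNeg (normFactor d) {{ℚ.pos⇒nonNeg (normFactor d) {{normFactor-positive d}}}} (ι-mono-≤ le))

emb-nonzero : ∀ {y : V d} {Y} → (∀ i → y i ≡ emb d Y i) → NonZeroV y → ∃ λ i → Y i ≢ 0ℤ
emb-nonzero {d} {Y = Y} e nz with zero? Y
... | inj₂ w = w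
... | inj₁ z = contradiction (λ i → trans (e i) (trans (cong (λ a → pow2inv d ℚ.* ι a) (z i)) (ℚ.*-zeroʳ (pow2inv d)))) nz

emb-nonzero-N : ∀ {K k} {y : V d} {Y} → (∀ i → y i ≡ emb K Y i) → N Y ≡ + (2 ℕ.^ k) → NonZeroV y
emb-nonzero-N {K = K} {k} {Y = Y} e norm z = proj₂ Yi (emb-injective-0 {K = K} {X = Y} (λ i → trans (sym (e i)) (z i)) (proj₁ Yi))
  where Yi = N-nonzero {X = Y} {k = k} norm

-- A multiple of a single basis vector; `Form-odd` doubles it to a line. The latter shows that the
-- bound 2^k is attained in the odd index of the image under f - 1.
Form-even : ∀ d j → ∃ λ (X : Fn d) → Form (2 * j) X
Form-even zero j = (λ _ → + (2 ℕ.^ j)) , Form-origin j false {λ _ → + (2 ℕ.^ j)} refl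
Form-even (suc d) j = spread (on false) (proj₁ (Form-even d j)) , Form-on false (proj₂ (Form-even d j))

Form-odd : ∀ d j → ∃ λ (X : Fn (suc d)) → Form (suc (2 * j)) X
Form-odd d j = spread (alternate false) (proj₁ (Form-even d j)) , Form-alternate false (proj₂ (Form-even d j))

Λ-norm≤ : ∀ (f : Word (suc d)) → Fourvolution f → ∀ {y Y} → (∀ i → y i ≡ emb (suc d) Y i) →
  (∀ z → Lminus (BW (suc d)) f z → NonZeroV z → normV y ℚ.≤ normV z) →
  ∀ {k W} → Λ (suc (2 * suc d)) (suc d) W → N W ≡ + (2 ℕ.^ k) → N Y ℤ.≤ N W
Λ-norm≤ {d} f four {Y = Y} y≗Y y-min {k} {W} v norm = normV-cancel {Y = Y} {W} y≗Y (λ _ → refl)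
  (y-min (emb (suc d) W) (Λ⇒Lminus f four {Y = W} v (λ _ → refl)) (emb-nonzero-N {K = suc d} {k} {Y = W} (λ _ → refl) norm))

-- Comparison with the explicit vector from `Form-odd` bounds N Y above by 2^κ, `Λ-min` bounds it
-- below by the same number, and the classification applies.
minimal⇒Form : ∀ (f : Word (suc d)) → Fourvolution f → ∀ {y} → MinimalVector (Lminus (BW (suc d)) f) y →
  ∃ λ Y → Form (suc (2 * suc d)) Y × (∀ i → y i ≡ emb (suc d) Y i)
minimal⇒Form {d} f four {y} (y∈L , y≢0 , y-min) = go (Lminus⇒Λ f y∈L) (Form-odd d (suc d))
  where
  κ = suc (2 * suc d)
  go : (∃ λ Y → Λ κ (suc d) Y × (∀ i → y i ≡ emb (suc d) Y i)) → (∃ λ W → Form κ {suc d} W) →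
    ∃ λ Y → Form κ Y × (∀ i → y i ≡ emb (suc d) Y i)
  go (Y , v , y≗Y) (W , G) = Y , Λ-classify v (ℤ.≤-antisym
      (subst (N Y ℤ.≤_) (Form-N G) (Λ-norm≤ f four {Y = Y} y≗Y y-min {κ} {W} (Form⇒Λ G) (Form-N G)))
      (Λ-min v (emb-nonzero y≗Y y≢0))) , y≗Y

Form⇒minimal : ∀ (f : Word (suc d)) → Fourvolution f → ∀ {y Y} → Form (suc (2 * suc d)) Y → (∀ i → y i ≡ emb (suc d) Y i) →
  MinimalVector (Lminus (BW (suc d)) f) y
Form⇒minimal {d} f four {y} {Y} F y≗Y =
    Λ⇒Lminus f four (Form⇒Λ F) y≗Y
  , emb-nonzero-N {K = suc d} {suc (2 * suc d)} {Y = Y} y≗Y (Form-N F)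
  , λ z z∈L z≢0 → bound z z≢0 (Lminus⇒Λ f z∈L)
  where
  bound : ∀ z → NonZeroV z → (∃ λ Z → Λ (suc (2 * suc d)) (suc d) Z × (∀ i → z i ≡ emb (suc d) Z i)) → normV y ℚ.≤ normV z
  bound z z≢0 (Z , v , z≗Z) = normV-mono {Y = Y} {Z} y≗Y z≗Z
    (subst (ℤ._≤ N Z) (sym (Form-N F)) (Λ-min v (emb-nonzero z≗Z z≢0)))

odd-flat⇒Form : ∀ {m} (A : Affine d (2 * m + 1)) {S} {y : V d} → RM 2 d S → (∀ i → y i ≡ scale (pow2inv m) (ε S (vA A)) i) →
  ∃ λ Y → Form (suc (2 * d)) Y × (∀ i → y i ≡ emb d Y i)
odd-flat⇒Form {d} {m} A {y = y} rm e = go (flat⇒Form {m = m} {K = d} {A = A} rm m≤d e)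
  where
  m≤d : m ≤ d
  m≤d = ℕ.≤-trans (ℕ.≤-trans (ℕ.m≤n*m m 2) (ℕ.m≤m+n (2 * m) 1)) (dim≤ A)
  size : 2 * (d ∸ m) + (2 * m + 1) ≡ suc (2 * d)
  size = trans (sym (ℕ.+-assoc (2 * (d ∸ m)) (2 * m) 1)) (trans (ℕ.+-comm _ 1)
    (cong suc (trans (sym (ℕ.*-distribˡ-+ 2 (d ∸ m) m)) (cong (2 *_) (ℕ.m∸n+n≡m m≤d)))))
  go : (∃ λ Y → Form (2 * (d ∸ m) + (2 * m + 1)) {d} Y × (∀ i → y i ≡ emb d Y i)) →
    ∃ λ Y → Form (suc (2 * d)) Y × (∀ i → y i ≡ emb d Y i)
  go (Y , F , y≗Y) = Y , subst (λ k → Form k Y) size F , y≗Y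

theorem10p1 : (d : ℕ) → 2 ≤ d → (f : Word d) → Fourvolution f → (y : V d) →
    (MinimalVector (Lminus (BW d) f) y →
    Σ ℕ λ m → Σ (Affine d (2 * m + 1)) λ A → Σ (Subset d) λ S →
    RM 2 d S × (∀ i → y i ≡ scale (pow2inv m) (ε S (vA A)) i))
    × ((Σ ℕ λ m → Σ (Affine d (2 * m + 1)) λ A → Σ (Subset d) λ S →
    RM 2 d S × (∀ i → y i ≡ scale (pow2inv m) (ε S (vA A)) i)) →
    MinimalVector (Lminus (BW d) f) y)
theorem10p1 (suc d) _ f four y =
    (λ minimal → let Y , F , y≗Y = minimal⇒Form f four minimal
                     m , A , S , rm , e = Form⇒flat {e = 1} {suc d} ℕ.≤-refl F
                 in m , A , S , rm , λ i → trans (y≗Y i) (e i))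
  , (λ { (m , A , S , rm , e) → let Y , F , y≗Y = odd-flat⇒Form {m = m} A rm e in Form⇒minimal f four F y≗Y })
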